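{- Let $\mathcal{A}$ be a subset of $4\mathbb{Z}^+$ containing $4$ and $8$, and let $\Psi_{\mathcal{A}} \subseteq \mathrm{GL}(2,\mathbb{Z})$ be the semigroup corresponding to continued fractions built from this alphabet, i.e. \[ \Psi_\mathcal{A} = \left\langle \begin{pmatrix} 0 & 1\\ 1 & a\end{pmatrix} : a \in \mathcal{A} \right\rangle^+. \] Then $\Psi_{\mathcal{A}}\begin{pmatrix} x\\ y\end{pmatrix}$ exhibits reciprocity obstructions in the denominator if $y\equiv 1\pmod{4}$, $x$ is odd, and $\left(\frac{x}{y}\right)=-1$.
   Context: $\left(\frac{x}{y}\right)$ denotes the Kronecker symbol; $\langle\cdots\rangle^+$ denotes the monoid generated (including the identity). For $\begin{pmatrix} u\\ v\end{pmatrix}$ in the orbit $\Psi_\mathcal{A}\begin{pmatrix} x\\ y\end{pmatrix}$, $v$ is the denominator. Reciprocity obstruction in the denominator means: the set of denominators contains squares modulo every $n\ge 1$, but contains no integer squares. -}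

module Defs where

open import Data.Nat as ℕ using (ℕ; zero; suc)
open import Data.Integer as ℤ using (ℤ; +_; -[1+_]; _+_; _*_; _-_; ∣_∣; 0ℤ; 1ℤ; -1ℤ)
open import Data.Integer.DivMod using (_%ℕ_)
open import Data.Integer.Divisibility using (_∣_)
open import Data.Nat.Primality.Factorisation using (factorise; factors)
open import Data.List using (List; []; _∷_; foldr; map; upTo)
open import Data.Bool.ListAction using (any)
open import Data.Bool using (Bool; true; false; if_then_else_)
open import Data.Product using (Σ; ∃; _×_; _,_)
open import Relation.Nullary.Decidable using (⌊_⌋)

-- Legendre symbol (a/p) for an odd prime p (Euler's definition):
-- 0 if p ∣ a, 1 if a is a nonzero square mod p, -1 otherwise.
-- For p = 2 the Kronecker convention: (a/2) = 0 (a even), 1 (a ≡ ±1 mod 8), -1 (a ≡ ±3 mod 8).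
legendre : ℤ → ℕ → ℤ
legendre a zero = 0ℤ
legendre a (suc zero) = 1ℤ
legendre a (suc (suc zero)) with a %ℕ 8
... | 1 = 1ℤ
... | 7 = 1ℤ
... | 3 = -1ℤ
... | 5 = -1ℤ
... | _ = 0ℤ
legendre a p@(suc (suc (suc k))) with a %ℕ p
... | zero = 0ℤ
... | r@(suc _) =
  if any (λ t → ⌊ (t ℕ.* t) ℕ.% p ℕ.≟ r ⌋) (upTo p) then 1ℤ else -1ℤ

kronecker : ℤ → ℤ → ℤ
kronecker a (+ zero) with ∣ a ∣
... | 1 = 1ℤ
... | _ = 0ℤ
kronecker a (+ (suc m)) =
  foldr (λ p r → legendre a p * r) 1ℤ (factors (factorise (suc m)))
kronecker a -[1+ m ] = signPart a * kronecker a (+ (suc m))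
  where
  signPart : ℤ → ℤ
  signPart (+ _) = 1ℤ
  signPart -[1+ _ ] = -1ℤ

record Mat : Set where
  constructor mat
  field
    m11 m12 m21 m22 : ℤ

_⊗_ : Mat → Mat → Mat
mat a b c d ⊗ mat e f g h = mat (a * e + b * g) (a * f + b * h) (c * e + d * g) (c * f + d * h)

I₂ : Mat
I₂ = mat 1ℤ 0ℤ 0ℤ 1ℤ

gen : ℕ → Mat
gen a = mat 0ℤ 1ℤ 1ℤ (+ a)

data InΨ (A : ℕ → Set) : Mat → Set where
  ψ-id  : InΨ A I₂
  ψ-mul : ∀ {M a} → InΨ A M → A a → InΨ A (M ⊗ gen a)

Denominator : (ℕ → Set) → ℤ → ℤ → ℤ → Set
Denominator A x y v =
  Σ Mat λ γ → InΨ A γ × (Mat.m21 γ * x + Mat.m22 γ * y ≡ v)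
  where open import Relation.Binary.PropositionalEquality using (_≡_)

ReciprocityObstruction : (ℕ → Set) → ℤ → ℤ → Set
ReciprocityObstruction A x y =
  ((n : ℕ) → 1 ℕ.≤ n → Σ ℤ λ v → Denominator A x y v × Σ ℤ λ s → (+ n) ∣ (v - s * s))
  × ((v : ℤ) → Denominator A x y v → (s : ℤ) → ¬ (v ≡ s * s))
  where
  open import Relation.Binary.PropositionalEquality using (_≡_)
  open import Relation.Nullary using (¬_)

{-# OPTIONS --safe #-}

-- The second coordinates v of the orbit are produced by the steps (x, y) ↦ (y, x + a y), a ∈ A.
--
-- No squares: since 4 ∣ a, along the orbit both entries stay odd and one of them stays ≡ 1 (mod 4).
-- Quadratic reciprocity and periodicity then give (y / (x + a y)) = ((x + a y) / y) = (x / y) = -1 unless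
-- both y and x + a y are negative, in which case all later denominators are negative.  A square
-- v = s² is positive and has (u / v) = (u / s)² ≠ -1.  Reciprocity for odd primes is Eisenstein's
-- lattice point count based on Gauss's lemma; Euler's criterion follows from Gauss's lemma and the
-- bound on the number of roots of xʰ - 1 modulo p = 2h + 1.
--
-- Squares modulo n: modulo n the generator g₄ has finite order, so the unipotent matrices
-- g₄⁻¹ g₈ : (x, y) ↦ (x + 4 y, y) and g₈ g₄⁻¹ : (x, y) ↦ (x, y + 4 x) act on the orbit.  The first makes
-- x a unit modulo n, because x is coprime to 4 y; the second then makes y ≡ 1, because 4 ∣ y - 1.

module Submission where

open import Defs
open import Data.Nat using (ℕ; zero; suc; ⌊_/2⌋)
open import Data.Integer using (ℤ; +_; -[1+_]; _+_; _*_; _-_; -_; _^_; ∣_∣; 0ℤ; 1ℤ; -1ℤ)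
open import Data.Integer.Divisibility using (_∣_)
open import Data.Product using (Σ; ∃; ∃₂; _×_; _,_; proj₁; proj₂)
open import Relation.Binary.PropositionalEquality as ≡ using (_≡_; _≢_; cong; cong₂; sym; subst; module ≡-Reasoning)
open import Relation.Nullary using (¬_; yes; no; contradiction)

import Data.Nat as ℕ
import Data.Nat.Properties as ℕ
import Data.Nat.Divisibility as ℕ
import Data.Nat.DivMod as ℕ
import Data.Integer.Properties as ℤ
open import Algebra.Properties.CommutativeSemigroup ℤ.*-commutativeSemigroup using (interchange; x∙yz≈y∙xz)
open import Data.Bool using (true; false; T)
open import Data.Bool.ListAction using (any)
open import Data.Fin using (Fin; toℕ; fromℕ<; combine)
open import Data.Fin.Properties using (pigeonhole; combine-injective; fromℕ<-injective)
open import Data.Integer.DivMod using (_%ℕ_; _/ℕ_; n%ℕd<d; a≡a%ℕn+[a/ℕn]*n)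
open import Data.Integer.Divisibility.Signed using (∣ᵤ⇒∣; ∣⇒∣ᵤ; divides)
open import Data.Integer.Tactic.RingSolver using (solve-∀)
open import Data.List using (List; []; _∷_; _++_; map; length; foldr; replicate; applyDownFrom; upTo)
open import Data.List.Membership.Propositional using (_∈_; lose)
open import Data.List.Membership.Propositional.Properties using (∈-∃++; ∈-upTo⁺; ∈-applyDownFrom⁺)
open import Data.List.Properties using (length-applyDownFrom; length-map; length-replicate)
open import Data.List.Relation.Binary.Permutation.Propositional using (_↭_; refl; prep; swap; trans; ↭-sym; ↭-trans)
open import Data.List.Relation.Binary.Permutation.Propositional.Properties using (shift; ∈-resp-↭; ↭-length)
open import Data.List.Relation.Unary.All as All using (All; []; _∷_)
import Data.List.Relation.Unary.All.Properties as All
open import Data.List.Relation.Unary.AllPairs using (AllPairs; []; _∷_)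
import Data.List.Relation.Unary.AllPairs.Properties as AllPairs
open import Data.List.Relation.Unary.Any as Any using (here; there)
open import Data.List.Relation.Unary.Any.Properties using (any⁺; any⁻)
open import Data.List.Relation.Unary.Unique.Propositional using (Unique)
open import Data.Nat.Coprimality using (prime⇒coprime; coprime-Bézout)
open import Data.Nat.GCD using (module Bézout)
open import Data.Nat.ListAction using (product)
open import Data.Nat.ListAction.Properties using (product-++)
open import Data.Nat.Primality using (Prime; euclidsLemma; prime⇒nonZero; prime⇒nonTrivial; prime⇒irreducible; irreducible[2])
open import Data.Nat.Primality.Factorisation using (PrimeFactorisation; factorise; factors; factorisationUnique; factorisationHasAllPrimeFactors)
open import Data.Nat.Tactic.RingSolver renaming (solve-∀ to solveℕ-∀)
open import Data.Sum using (_⊎_; inj₁; inj₂; [_,_]′)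
open import Data.Unit using (tt)
open import Function using (_∘_; id)
open import Relation.Nullary.Decidable using (⌊_⌋; toWitness; fromWitness)
open ≡-Reasoning

-- Congruences

infix 4 _≡_[mod_]

-- The quotient is explicit and `a` stands alone on the left, so matching the equality with `refl`
-- eliminates `a` and leaves polynomial identities for the ring solver.
record _≡_[mod_] (a b : ℤ) (n : ℕ) : Set where
  constructor quot_eq_
  field
    quotient : ℤ
    equality : a ≡ b + quotient * + n

module _ {n : ℕ} where

  ≡⇒mod : ∀ {a b} → a ≡ b → a ≡ b [mod n ]
  ≡⇒mod {b = b} ≡.refl = quot 0ℤ eq sym (ℤ.+-identityʳ b)

  mod-sym : ∀ {a b} → a ≡ b [mod n ] → b ≡ a [mod n ]
  mod-sym {b = b} (quot q eq ≡.refl) = quot (- q) eq lemma b q (+ n)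
    where
    lemma : ∀ b q n → b ≡ b + q * n + - q * n
    lemma = solve-∀

  mod-trans : ∀ {a b c} → a ≡ b [mod n ] → b ≡ c [mod n ] → a ≡ c [mod n ]
  mod-trans {c = c} (quot q eq ≡.refl) (quot r eq ≡.refl) = quot (q + r) eq lemma c q r (+ n)
    where
    lemma : ∀ c q r n → c + r * n + q * n ≡ c + (q + r) * n
    lemma = solve-∀

  mod-+ : ∀ {a b c d} → a ≡ b [mod n ] → c ≡ d [mod n ] → a + c ≡ b + d [mod n ]
  mod-+ {b = b} {d = d} (quot q eq ≡.refl) (quot r eq ≡.refl) = quot (q + r) eq lemma b d q r (+ n)
    where
    lemma : ∀ b d q r n → (b + q * n) + (d + r * n) ≡ b + d + (q + r) * n
    lemma = solve-∀

  mod-* : ∀ {a b c d} → a ≡ b [mod n ] → c ≡ d [mod n ] → a * c ≡ b * d [mod n ]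
  mod-* {b = b} {d = d} (quot q eq ≡.refl) (quot r eq ≡.refl) =
    quot (b * r + q * d + q * r * + n) eq lemma b d q r (+ n)
    where
    lemma : ∀ b d q r n → (b + q * n) * (d + r * n) ≡ b * d + (b * r + q * d + q * r * n) * n
    lemma = solve-∀

  mod-*ˡ : ∀ a {c d} → c ≡ d [mod n ] → a * c ≡ a * d [mod n ]
  mod-*ˡ a = mod-* (≡⇒mod {a} ≡.refl)

  mod-^ : ∀ {a b} k → a ≡ b [mod n ] → a ^ k ≡ b ^ k [mod n ]
  mod-^ zero    _ = ≡⇒mod ≡.refl
  mod-^ (suc k) e = mod-* e (mod-^ k e)

  mod-neg : ∀ {a b} → a ≡ b [mod n ] → - a ≡ - b [mod n ]
  mod-neg {b = b} (quot q eq ≡.refl) = quot (- q) eq lemma b q (+ n)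
    where
    lemma : ∀ b q n → - (b + q * n) ≡ - b + - q * n
    lemma = solve-∀

  mod⇒∣ : ∀ {a b} → a ≡ b [mod n ] → + n ∣ (a - b)
  mod⇒∣ {b = b} (quot q eq ≡.refl) = ∣⇒∣ᵤ (divides q (lemma b q (+ n)))
    where
    lemma : ∀ b q n → b + q * n - b ≡ q * n
    lemma = solve-∀

  ∣⇒mod : ∀ a b → + n ∣ (a - b) → a ≡ b [mod n ]
  ∣⇒mod a b n∣a-b with divides q e ← ∣ᵤ⇒∣ n∣a-b = quot q eq (≡.trans (lemma a b) (cong (λ r → b + r) e))
    where
    lemma : ∀ a b → a ≡ b + (a - b)
    lemma = solve-∀

  mod0⇒∣ : ∀ {a} → a ≡ 0ℤ [mod n ] → n ℕ.∣ ∣ a ∣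
  mod0⇒∣ {a} a≡0 = subst (λ z → n ℕ.∣ ∣ z ∣) (ℤ.+-identityʳ a) (mod⇒∣ a≡0)

  ∣⇒mod0 : ∀ a → n ℕ.∣ ∣ a ∣ → a ≡ 0ℤ [mod n ]
  ∣⇒mod0 a n∣a = ∣⇒mod a 0ℤ (subst (λ z → n ℕ.∣ ∣ z ∣) (sym (ℤ.+-identityʳ a)) n∣a)

  mod-difference : ∀ {a b} → a ≡ b [mod n ] → a - b ≡ 0ℤ [mod n ]
  mod-difference {b = b} a≡b = mod-trans (mod-+ a≡b (≡⇒mod ≡.refl)) (≡⇒mod (ℤ.+-inverseʳ b))

  difference-mod : ∀ a b → a - b ≡ 0ℤ [mod n ] → a ≡ b [mod n ]
  difference-mod a b e = ∣⇒mod a b (mod0⇒∣ e)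

  mod-%ℕ : .{{_ : ℕ.NonZero n}} → ∀ a → a ≡ + (a %ℕ n) [mod n ]
  mod-%ℕ a = quot (a /ℕ n) eq a≡a%ℕn+[a/ℕn]*n a n

-- The only multiple of n of absolute value below n is 0. This is what turns congruences between
-- small symbol values into equalities.
mod-close : ∀ {n a b} → a ≡ b [mod n ] → ∣ a - b ∣ ℕ.< n → a ≡ b
mod-close {n} {a} {b} a≡b ∣a-b∣<n = ℤ.i-j≡0⇒i≡j a b (ℤ.∣i∣≡0⇒i≡0 (vanishes ∣a-b∣<n (mod⇒∣ a≡b)))
  where
  vanishes : ∀ {m} → m ℕ.< n → n ℕ.∣ m → m ≡ 0
  vanishes {zero}  _   _   = ≡.refl
  vanishes {suc m} m<n n∣m = contradiction (ℕ.∣⇒≤ n∣m) (ℕ.<⇒≱ m<n)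

mod-small : ∀ {n i j} → + i ≡ + j [mod n ] → i ℕ.< n → j ℕ.< n → i ≡ j
mod-small {n} {i} {j} e i<n j<n = ℤ.+-injective (mod-close e (ℕ.≤-<-trans
  (subst (ℕ._≤ i ℕ.⊔ j) (cong ∣_∣ (sym (ℤ.m-n≡m⊖n i j))) (ℤ.∣m⊝n∣≤m⊔n i j))
  (ℕ.⊔-lub i<n j<n)))

mod-euclid : ∀ {p} → Prime p → ∀ a b → a * b ≡ 0ℤ [mod p ] → a ≡ 0ℤ [mod p ] ⊎ b ≡ 0ℤ [mod p ]
mod-euclid {p} pr a b ab≡0
  with euclidsLemma ∣ a ∣ ∣ b ∣ pr (subst (p ℕ.∣_) (ℤ.abs-* a b) (mod0⇒∣ ab≡0))
... | inj₁ p∣a = inj₁ (∣⇒mod0 a p∣a)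
... | inj₂ p∣b = inj₂ (∣⇒mod0 b p∣b)

mod-cancelʳ : ∀ {p} → Prime p → ∀ a b c → ¬ c ≡ 0ℤ [mod p ] → a * c ≡ b * c [mod p ] → a ≡ b [mod p ]
mod-cancelʳ pr a b c c≢0 ac≡bc
  with mod-euclid pr (a - b) c (mod-trans (≡⇒mod (lemma a b c)) (mod-difference ac≡bc))
  where
  lemma : ∀ a b c → (a - b) * c ≡ a * c - b * c
  lemma = solve-∀
... | inj₁ a-b≡0 = difference-mod a b a-b≡0
... | inj₂ c≡0   = contradiction c≡0 c≢0

-- Signs and powers of -1

-1^_ : ℕ → ℤ
-1^ n = -1ℤ ^ n

-1^-+ : ∀ m n → -1^ (m ℕ.+ n) ≡ -1^ m * -1^ n
-1^-+ = ℤ.^-distribˡ-+-* -1ℤ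

-1^-sign : ∀ n → -1^ n ≡ 1ℤ ⊎ -1^ n ≡ -1ℤ
-1^-sign zero = inj₁ ≡.refl
-1^-sign (suc n) with -1^-sign n
... | inj₁ e = inj₂ (cong (-1ℤ *_) e)
... | inj₂ e = inj₁ (cong (-1ℤ *_) e)

IsSign : ℤ → Set
IsSign a = a * a ≡ 1ℤ

-1^-isSign : ∀ n → IsSign (-1^ n)
-1^-isSign n with -1^-sign n
... | inj₁ e = cong₂ _*_ e e
... | inj₂ e = cong₂ _*_ e e

-1^-double : ∀ n → -1^ (n ℕ.+ n) ≡ 1ℤ
-1^-double n = ≡.trans (-1^-+ n n) (-1^-isSign n)

isSign⇒±1 : ∀ s → IsSign s → s ≡ 1ℤ ⊎ s ≡ -1ℤ
isSign⇒±1 (+ m)    ss = inj₁ (cong +_ (ℕ.m*n≡1⇒m≡1 m m (≡.trans (sym (ℤ.abs-* (+ m) (+ m))) (cong ∣_∣ ss))))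
isSign⇒±1 -[1+ m ] ss = inj₂ (cong -[1+_] (ℕ.suc-injective (ℕ.m*n≡1⇒m≡1 (suc m) (suc m) (cong ∣_∣ ss))))

sign-cancelˡ : ∀ s {a b} → IsSign s → s * a ≡ s * b → a ≡ b
sign-cancelˡ s {a} {b} ss sa≡sb = begin
  a           ≡⟨ ℤ.*-identityˡ a ⟨
  1ℤ * a      ≡⟨ cong (_* a) ss ⟨
  s * s * a   ≡⟨ ℤ.*-assoc s s a ⟩
  s * (s * a) ≡⟨ cong (s *_) sa≡sb ⟩
  s * (s * b) ≡⟨ ℤ.*-assoc s s b ⟨
  s * s * b   ≡⟨ cong (_* b) ss ⟩
  1ℤ * b      ≡⟨ ℤ.*-identityˡ b ⟩
  b           ∎

-- Products over lists

∏ : {A : Set} → List A → (A → ℤ) → ℤ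
∏ xs f = foldr (λ x r → f x * r) 1ℤ xs

module _ {A : Set} where

  ∏-↭ : ∀ f {xs ys : List A} → xs ↭ ys → ∏ xs f ≡ ∏ ys f
  ∏-↭ f refl         = ≡.refl
  ∏-↭ f (prep x e)   = cong (f x *_) (∏-↭ f e)
  ∏-↭ f (swap {xs} {ys} x y e) = ≡.trans (cong (λ r → f x * (f y * r)) (∏-↭ f e)) (x∙yz≈y∙xz (f x) (f y) (∏ ys f))
  ∏-↭ f (trans e e′) = ≡.trans (∏-↭ f e) (∏-↭ f e′)

  ∏-++ : ∀ f (xs ys : List A) → ∏ (xs ++ ys) f ≡ ∏ xs f * ∏ ys f
  ∏-++ f []       ys = sym (ℤ.*-identityˡ _)
  ∏-++ f (x ∷ xs) ys = ≡.trans (cong (f x *_) (∏-++ f xs ys)) (sym (ℤ.*-assoc (f x) _ _))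

  ∏-cong : ∀ {f g : A → ℤ} {xs} → All (λ x → f x ≡ g x) xs → ∏ xs f ≡ ∏ xs g
  ∏-cong []       = ≡.refl
  ∏-cong (e ∷ es) = cong₂ _*_ e (∏-cong es)

  ∏-mod : ∀ {n} {f g : A → ℤ} {xs} → All (λ x → f x ≡ g x [mod n ]) xs → ∏ xs f ≡ ∏ xs g [mod n ]
  ∏-mod []       = ≡⇒mod ≡.refl
  ∏-mod (e ∷ es) = mod-* e (∏-mod es)

  ∏-* : ∀ (f g : A → ℤ) xs → ∏ xs (λ x → f x * g x) ≡ ∏ xs f * ∏ xs g
  ∏-* f g []       = ≡.refl
  ∏-* f g (x ∷ xs) = ≡.trans (cong (f x * g x *_) (∏-* f g xs)) (interchange (f x) (g x) (∏ xs f) (∏ xs g))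

  ∏-const : ∀ c (xs : List A) → ∏ xs (λ _ → c) ≡ c ^ length xs
  ∏-const c []       = ≡.refl
  ∏-const c (x ∷ xs) = cong (c *_) (∏-const c xs)

  ∏-map : ∀ {B : Set} (f : B → ℤ) (g : A → B) xs → ∏ (map g xs) f ≡ ∏ xs (f ∘ g)
  ∏-map f g []       = ≡.refl
  ∏-map f g (x ∷ xs) = cong (f (g x) *_) (∏-map f g xs)

  ∏-isSign : ∀ (f : A → ℤ) xs → (∀ x → IsSign (f x)) → IsSign (∏ xs f)
  ∏-isSign f xs fs = begin
    ∏ xs f * ∏ xs f        ≡⟨ ∏-* f f xs ⟨
    ∏ xs (λ x → f x * f x) ≡⟨ ∏-cong (All.universal fs xs) ⟩
    ∏ xs (λ _ → 1ℤ)        ≡⟨ ∏-const 1ℤ xs ⟩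
    1ℤ ^ length xs         ≡⟨ ℤ.^-zeroˡ (length xs) ⟩
    1ℤ                     ∎

∏-swap : ∀ {A B : Set} (f : A → B → ℤ) xs ys →
  ∏ xs (λ x → ∏ ys (f x)) ≡ ∏ ys (λ y → ∏ xs (λ x → f x y))
∏-swap f []       ys = sym (≡.trans (∏-const 1ℤ ys) (ℤ.^-zeroˡ (length ys)))
∏-swap f (x ∷ xs) ys = ≡.trans (cong (∏ ys (f x) *_) (∏-swap f xs ys)) (sym (∏-* (f x) _ ys))

∏-≢0 : ∀ {p} → Prime p → ∀ {A : Set} {f : A → ℤ} {xs} →
  All (λ x → ¬ f x ≡ 0ℤ [mod p ]) xs → ¬ ∏ xs f ≡ 0ℤ [mod p ]
∏-≢0 {p} pr []       e with mod0⇒∣ e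
... | p∣1 = ℕ.<-irrefl (sym (ℕ.∣1⇒≡1 p∣1)) (ℕ.nonTrivial⇒n>1 p {{prime⇒nonTrivial pr}})
∏-≢0 pr {f = f} {x ∷ xs} (x≢0 ∷ xs≢0) e with mod-euclid pr (f x) (∏ xs f) e
... | inj₁ x≡0  = x≢0 x≡0
... | inj₂ xs≡0 = ∏-≢0 pr xs≢0 xs≡0

-- Pigeonhole by induction: the head of xs is removed from ys, and the rest of xs still lies in what
-- remains because it does not contain that head.
unique⊆⇒↭ : ∀ {A : Set} {xs ys : List A} →
  Unique xs → All (_∈ ys) xs → length ys ℕ.≤ length xs → xs ↭ ys
unique⊆⇒↭ {ys = []} [] [] _ = refl
unique⊆⇒↭ {xs = x ∷ xs} (x∉xs ∷ uxs) (x∈ys ∷ xs⊆ys) len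
  with as , bs , ≡.refl ← ∈-∃++ x∈ys =
    ↭-trans (prep x (unique⊆⇒↭ uxs (All.zipWith shrink (x∉xs , xs⊆ys)) (ℕ.s≤s⁻¹ (subst (ℕ._≤ _) (↭-length moved) len))))
            (↭-sym moved)
  where
  moved = shift x as bs
  shrink : ∀ {z} → x ≢ z × z ∈ as ++ x ∷ bs → z ∈ as ++ bs
  shrink (x≢z , z∈) with ∈-resp-↭ moved z∈
  ... | here z≡x  = contradiction (sym z≡x) x≢z
  ... | there z∈′ = z∈′

-- Roots of polynomials modulo a prime

-- The coefficients are listed from the constant term up, with an implicit leading coefficient 1.
evalMonic : List ℤ → ℤ → ℤ
evalMonic []       x = 1ℤ
evalMonic (c ∷ cs) x = c + x * evalMonic cs x

-- Horner's scheme for the quotient of f(X) - f(r) by X - r, which is again monic: its coefficients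
-- are the values at r of the tails of f. The clause for the constant polynomial 1 is a filler.
divideByRoot : List ℤ → ℤ → List ℤ
divideByRoot []            r = []
divideByRoot (c ∷ [])      r = []
divideByRoot (c ∷ d ∷ cs) r = evalMonic (d ∷ cs) r ∷ divideByRoot (d ∷ cs) r

length-divideByRoot : ∀ c cs r → length (divideByRoot (c ∷ cs) r) ≡ length cs
length-divideByRoot c []       r = ≡.refl
length-divideByRoot c (d ∷ cs) r = cong suc (length-divideByRoot d cs r)

divideByRoot-spec : ∀ c cs r x →
  evalMonic (c ∷ cs) x - evalMonic (c ∷ cs) r ≡ (x - r) * evalMonic (divideByRoot (c ∷ cs) r) x
divideByRoot-spec c []       r x = lemma c r x
  where
  lemma : ∀ c r x → c + x * 1ℤ - (c + r * 1ℤ) ≡ (x - r) * 1ℤ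
  lemma = solve-∀
divideByRoot-spec c (d ∷ cs) r x = begin
  c + x * gx - (c + r * gr)       ≡⟨ split c x r gx gr ⟩
  x * (gx - gr) + (x - r) * gr    ≡⟨ cong (λ z → x * z + (x - r) * gr) (divideByRoot-spec d cs r x) ⟩
  x * ((x - r) * q) + (x - r) * gr ≡⟨ collect x r q gr ⟩
  (x - r) * (gr + x * q)          ∎
  where
  gx = evalMonic (d ∷ cs) x
  gr = evalMonic (d ∷ cs) r
  q  = evalMonic (divideByRoot (d ∷ cs) r) x
  split : ∀ c x r gx gr → c + x * gx - (c + r * gr) ≡ x * (gx - gr) + (x - r) * gr
  split = solve-∀
  collect : ∀ x r q gr → x * ((x - r) * q) + (x - r) * gr ≡ (x - r) * (gr + x * q)
  collect = solve-∀

1≢0-mod-prime : ∀ {p} → Prime p → ¬ 1ℤ ≡ 0ℤ [mod p ]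
-- 1 is the empty product.
1≢0-mod-prime {p} pr = ∏-≢0 pr {f = λ (x : ℤ) → x} []

-- Lagrange's bound by induction on the degree: after division by X - r every other root s is a root
-- of the quotient, since p is prime and does not divide s - r. The constant polynomial 1 has no
-- root.
tooManyRoots : ∀ {p} → Prime p → ∀ cs rs →
  AllPairs (λ r s → ¬ r ≡ s [mod p ]) rs →
  All (λ r → evalMonic cs r ≡ 0ℤ [mod p ]) rs →
  ¬ length rs ≡ suc (length cs)
tooManyRoots pr []       (r ∷ []) _ (root ∷ []) _ = 1≢0-mod-prime pr root
tooManyRoots {p} pr (c ∷ cs) (r ∷ rs) (r∉rs ∷ distinct) (root ∷ roots) len =
  tooManyRoots pr (divideByRoot (c ∷ cs) r) rs distinct
    (All.zipWith quotientRoot (r∉rs , roots))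
    (≡.trans (ℕ.suc-injective len) (cong suc (sym (length-divideByRoot c cs r))))
  where
  quotientRoot : ∀ {s} → ¬ r ≡ s [mod p ] × evalMonic (c ∷ cs) s ≡ 0ℤ [mod p ] →
    evalMonic (divideByRoot (c ∷ cs) r) s ≡ 0ℤ [mod p ]
  quotientRoot {s} (r≢s , root′)
    with mod-euclid pr (s - r) (evalMonic (divideByRoot (c ∷ cs) r) s)
           (mod-trans (≡⇒mod (sym (divideByRoot-spec c cs r s))) (mod-+ root′ (mod-neg root)))
  ... | inj₁ s-r≡0 = contradiction (mod-sym (difference-mod s r s-r≡0)) r≢s
  ... | inj₂ q≡0   = q≡0

evalMonic-xⁿ : ∀ n x → evalMonic (replicate n 0ℤ) x ≡ x ^ n
evalMonic-xⁿ zero    x = ≡.refl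
evalMonic-xⁿ (suc n) x = ≡.trans (ℤ.+-identityˡ _) (cong (x *_) (evalMonic-xⁿ n x))

tooManyRootsOfUnity : ∀ {p} → Prime p → ∀ n → 1 ℕ.≤ n → ∀ rs →
  AllPairs (λ r s → ¬ r ≡ s [mod p ]) rs →
  All (λ r → r ^ n ≡ 1ℤ [mod p ]) rs →
  ¬ length rs ≡ suc n
tooManyRootsOfUnity {p} pr (suc n) _ rs distinct roots len =
  -- These are the lower coefficients of X^(n+1) - 1.
  tooManyRoots pr (-1ℤ ∷ replicate n 0ℤ) rs distinct (All.map (λ {r} → root r) roots)
    (≡.trans len (cong (suc ∘ suc) (sym (length-replicate n))))
  where
  root : ∀ r → r ^ suc n ≡ 1ℤ [mod p ] → evalMonic (-1ℤ ∷ replicate n 0ℤ) r ≡ 0ℤ [mod p ]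
  root r rⁿ≡1 = mod-+ (≡⇒mod {a = -1ℤ} ≡.refl)
    (mod-trans (≡⇒mod (cong (r *_) (evalMonic-xⁿ n r))) rⁿ≡1)

-- Gauss's lemma

[1⋯_] : ℕ → List ℕ
[1⋯_] = applyDownFrom suc

All-[1⋯] : ∀ {P : ℕ → Set} n → (∀ {k} → 1 ℕ.≤ k → k ℕ.≤ n → P k) → All P [1⋯ n ]
All-[1⋯] n Pk = All.applyDownFrom⁺₁ suc n (Pk (ℕ.s≤s ℕ.z≤n))

∈-[1⋯] : ∀ {n k} → 1 ℕ.≤ k → k ℕ.≤ n → k ∈ [1⋯ n ]
∈-[1⋯] {k = suc k} _ k<n = ∈-applyDownFrom⁺ suc k<n


-- The list is strictly decreasing, so a relation that forces equality holds for no pair of its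
-- entries. It serves for the injectivity of `image` and for the distinctness of the squares.
AllPairs-[1⋯] : ∀ {R : ℕ → ℕ → Set} n →
  (∀ {i j} → 1 ℕ.≤ i → i ℕ.≤ n → j ℕ.≤ n → R i j → i ≡ j) → AllPairs (λ i j → ¬ R i j) [1⋯ n ]
AllPairs-[1⋯] n R⇒≡ = AllPairs.applyDownFrom⁺₁ suc n λ j<i i<n r →
  ℕ.<-irrefl (sym (ℕ.suc-injective (R⇒≡ (ℕ.s≤s ℕ.z≤n) i<n (ℕ.<-trans j<i i<n) r))) j<i

module HalfSystem (h : ℕ) (prime : Prime (suc (h ℕ.+ h))) where

  p : ℕ
  p = suc (h ℕ.+ h)

  -- For r < p, the residue of r between -h and h has absolute value `fold r`, and `flips r` is 1
  -- exactly when it is negative.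
  fold : ℕ → ℕ
  fold r with r ℕ.≤? h
  ... | yes _ = r
  ... | no  _ = p ℕ.∸ r

  flips : ℕ → ℕ
  flips r with r ℕ.≤? h
  ... | yes _ = 0
  ... | no  _ = 1

  1≤fold : ∀ {r} → 1 ℕ.≤ r → r ℕ.< p → 1 ℕ.≤ fold r
  1≤fold {r} 1≤r r<p with r ℕ.≤? h
  ... | yes _ = 1≤r
  ... | no  _ = ℕ.m<n⇒0<n∸m r<p

  fold≤h : ∀ r → fold r ℕ.≤ h
  fold≤h r with r ℕ.≤? h
  ... | yes r≤h = r≤h
  ... | no  r≰h = ℕ.≤-trans (ℕ.∸-monoʳ-≤ p (ℕ.≰⇒> r≰h)) (ℕ.≤-reflexive (ℕ.m+n∸m≡n h h))

  fold-mod : ∀ {r} → r ℕ.< p → + r ≡ -1^ (flips r) * + fold r [mod p ]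
  fold-mod {r} r<p with r ℕ.≤? h
  ... | yes _ = ≡⇒mod (sym (ℤ.*-identityˡ _))
  ... | no  _ = quot 1ℤ eq (begin
    + r                                ≡⟨ lemma (+ r) (+ (p ℕ.∸ r)) ⟩
    -1ℤ * 1ℤ * + (p ℕ.∸ r) + 1ℤ * (+ (p ℕ.∸ r) + + r)
      ≡⟨ cong (λ z → -1ℤ * 1ℤ * + (p ℕ.∸ r) + 1ℤ * + z) (ℕ.m∸n+n≡m (ℕ.<⇒≤ r<p)) ⟩
    -1ℤ * 1ℤ * + (p ℕ.∸ r) + 1ℤ * + p ∎)
    where
    lemma : ∀ r m → r ≡ -1ℤ * 1ℤ * m + 1ℤ * (m + r)
    lemma = solve-∀

  -- As p is odd, r and p - r have opposite parities.
  fold-parity : ∀ {r} → r ℕ.< p → -1^ r ≡ -1^ (fold r) * -1^ (flips r)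
  fold-parity {r} r<p with r ℕ.≤? h
  ... | yes _ = sym (ℤ.*-identityʳ _)
  ... | no  _ = sign-cancelˡ (-1^ (p ℕ.∸ r)) (-1^-isSign (p ℕ.∸ r)) (begin
    -1^ (p ℕ.∸ r) * -1^ r                     ≡⟨ -1^-+ (p ℕ.∸ r) r ⟨
    -1^ (p ℕ.∸ r ℕ.+ r)                       ≡⟨ cong -1^_ (ℕ.m∸n+n≡m (ℕ.<⇒≤ r<p)) ⟩
    -1ℤ * -1^ (h ℕ.+ h)                       ≡⟨ cong (-1ℤ *_) (-1^-double h) ⟩
    -1ℤ                                       ≡⟨ cong (_* -1ℤ) (-1^-isSign (p ℕ.∸ r)) ⟨
    -1^ (p ℕ.∸ r) * -1^ (p ℕ.∸ r) * -1ℤ       ≡⟨ ℤ.*-assoc (-1^ (p ℕ.∸ r)) (-1^ (p ℕ.∸ r)) -1ℤ ⟩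
    -1^ (p ℕ.∸ r) * (-1^ (p ℕ.∸ r) * -1ℤ)     ∎)

  ≤h⇒<p : ∀ {k} → k ℕ.≤ h → k ℕ.< p
  ≤h⇒<p k≤h = ℕ.s≤s (ℕ.≤-trans k≤h (ℕ.m≤m+n h h))

  ≢0 : ∀ {k} → 1 ℕ.≤ k → k ℕ.< p → ¬ + k ≡ 0ℤ [mod p ]
  ≢0 1≤k k<p k≡0 with ≡.refl ← mod-small k≡0 k<p (ℕ.s≤s ℕ.z≤n) = contradiction 1≤k λ ()

  -- p divides (i - j)(i + j), but 1 ≤ i + j ≤ 2h < p, so it divides i - j.
  squares-injective : ∀ {i j} → 1 ℕ.≤ i → i ℕ.≤ h → j ℕ.≤ h →
    + i * + i ≡ + j * + j [mod p ] → i ≡ j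
  squares-injective {i} {j} 1≤i i≤h j≤h i²≡j²
    with mod-euclid prime (+ i - + j) (+ i + + j) (mod-trans (≡⇒mod (factor (+ i) (+ j))) (mod-difference i²≡j²))
    where
    factor : ∀ i j → (i - j) * (i + j) ≡ i * i - j * j
    factor = solve-∀
  ... | inj₁ i-j≡0 = mod-small (difference-mod (+ i) (+ j) i-j≡0) (≤h⇒<p i≤h) (≤h⇒<p j≤h)
  ... | inj₂ i+j≡0 = contradiction i+j≡0 (≢0 (ℕ.≤-trans 1≤i (ℕ.m≤m+n i j)) (ℕ.s≤s (ℕ.+-mono-≤ i≤h j≤h)))

  module _ (a : ℕ) (a≢0 : ¬ + a ≡ 0ℤ [mod p ]) where

    rem : ℕ → ℕ
    rem k = (a ℕ.* k) ℕ.% p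

    rem<p : ∀ k → rem k ℕ.< p
    rem<p k = ℕ.m%n<n (a ℕ.* k) p

    rem-mod : ∀ k → + a * + k ≡ + rem k [mod p ]
    rem-mod k = mod-trans (≡⇒mod (sym (ℤ.pos-* a k))) (mod-%ℕ (+ (a ℕ.* k)))

    1≤rem : ∀ {k} → 1 ℕ.≤ k → k ℕ.≤ h → 1 ℕ.≤ rem k
    1≤rem {k} 1≤k k≤h with rem k in eq
    ... | suc _ = ℕ.s≤s ℕ.z≤n
    ... | zero with mod-euclid prime (+ a) (+ k) (mod-trans (rem-mod k) (≡⇒mod (cong +_ eq)))
    ...   | inj₁ a≡0 = contradiction a≡0 a≢0
    ...   | inj₂ k≡0 = contradiction k≡0 (≢0 1≤k (≤h⇒<p k≤h))

    image : ℕ → ℕ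
    image k = fold (rem k)

    image-mod : ∀ k → + a * + k ≡ -1^ (flips (rem k)) * + image k [mod p ]
    image-mod k = mod-trans (rem-mod k) (fold-mod (rem<p k))

    image-square : ∀ k → + k * + k * + a * + a ≡ + image k * + image k [mod p ]
    image-square k = mod-trans (≡⇒mod (shuffle (+ k) (+ a)))
      (mod-trans (mod-* (image-mod k) (image-mod k)) (≡⇒mod signs-cancel))
      where
      shuffle : ∀ k a → k * k * a * a ≡ a * k * (a * k)
      shuffle = solve-∀
      regroup : ∀ s m → s * m * (s * m) ≡ s * s * (m * m)
      regroup = solve-∀
      s = -1^ (flips (rem k))
      m = + image k
      signs-cancel : s * m * (s * m) ≡ m * m
      signs-cancel = begin
        s * m * (s * m) ≡⟨ regroup s m ⟩
        s * s * (m * m) ≡⟨ cong (_* (m * m)) (-1^-isSign (flips (rem k))) ⟩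
        1ℤ * (m * m)    ≡⟨ ℤ.*-identityˡ (m * m) ⟩
        m * m           ∎

    -- Squaring removes the signs: equal images give (a i)² ≡ (a j)², the factor a is cancelled
    -- twice, and squares of 1, ..., h are distinct modulo p.
    image-injective : ∀ {i j} → 1 ℕ.≤ i → i ℕ.≤ h → j ℕ.≤ h → image i ≡ image j → i ≡ j
    image-injective {i} {j} 1≤i i≤h j≤h e = squares-injective 1≤i i≤h j≤h
      (mod-cancelʳ prime (+ i * + i) (+ j * + j) (+ a) a≢0
      (mod-cancelʳ prime (+ i * + i * + a) (+ j * + j * + a) (+ a) a≢0
        (mod-trans (image-square i)
        (mod-trans (≡⇒mod (cong (λ m → + m * + m) e)) (mod-sym (image-square j))))))

    image-↭ : map image [1⋯ h ] ↭ [1⋯ h ]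
    image-↭ = unique⊆⇒↭
      (AllPairs.map⁺ (AllPairs-[1⋯] h image-injective))
      (All.map⁺ (All-[1⋯] h λ {k} 1≤k k≤h → ∈-[1⋯] (1≤fold (1≤rem 1≤k k≤h) (rem<p k)) (fold≤h (rem k))))
      (ℕ.≤-reflexive (sym (length-map image [1⋯ h ])))

    gaussSign : ℤ
    gaussSign = ∏ [1⋯ h ] (λ k → -1^ (flips (rem k)))

    -- The congruences a k ≡ ± `image k` are multiplied over k. The images permute 1, ..., h, so h!
    -- appears on both sides and cancels.
    gaussLemma : (+ a) ^ h ≡ gaussSign [mod p ]
    gaussLemma = mod-cancelʳ prime ((+ a) ^ h) gaussSign h! h!≢0
      (mod-trans (≡⇒mod left) (mod-trans (∏-mod (All.universal image-mod [1⋯ h ])) (≡⇒mod right)))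
      where
      h! = ∏ [1⋯ h ] (λ k → + k)
      h!≢0 : ¬ h! ≡ 0ℤ [mod p ]
      h!≢0 = ∏-≢0 prime (All-[1⋯] h λ 1≤k k≤h → ≢0 1≤k (≤h⇒<p k≤h))
      left : (+ a) ^ h * h! ≡ ∏ [1⋯ h ] (λ k → + a * + k)
      left = begin
        (+ a) ^ h * h!                         ≡⟨ cong (λ m → (+ a) ^ m * h!) (length-applyDownFrom suc h) ⟨
        (+ a) ^ length [1⋯ h ] * h!            ≡⟨ cong (_* h!) (∏-const (+ a) [1⋯ h ]) ⟨
        ∏ [1⋯ h ] (λ _ → + a) * h!           ≡⟨ ∏-* (λ _ → + a) (λ k → + k) [1⋯ h ] ⟨
        ∏ [1⋯ h ] (λ k → + a * + k)          ∎
      right : ∏ [1⋯ h ] (λ k → -1^ (flips (rem k)) * + image k) ≡ gaussSign * h!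
      right = begin
        ∏ [1⋯ h ] (λ k → -1^ (flips (rem k)) * + image k)    ≡⟨ ∏-* (λ k → -1^ (flips (rem k))) (λ k → + image k) [1⋯ h ] ⟩
        gaussSign * ∏ [1⋯ h ] (λ k → + image k)              ≡⟨ cong (gaussSign *_) (∏-map (λ k → + k) image [1⋯ h ]) ⟨
        gaussSign * ∏ (map image [1⋯ h ]) (λ k → + k)                 ≡⟨ cong (gaussSign *_) (∏-↭ (λ k → + k) image-↭) ⟩
        gaussSign * h!                                       ∎

    gaussSign-isSign : IsSign gaussSign
    gaussSign-isSign = ∏-isSign (λ k → -1^ (flips (rem k))) [1⋯ h ] (λ k → -1^-isSign (flips (rem k)))

    -- Eisenstein's form: modulo 2, a k = p ⌊a k / p⌋ + rem k with a and p odd.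
    gaussSign-floor : ∀ b → a ≡ suc (b ℕ.+ b) → gaussSign ≡ ∏ [1⋯ h ] (λ k → -1^ ((a ℕ.* k) ℕ./ p))
    -- `S` is the product of (-1)^k and, by the permutation, also that of (-1)^(`image k`).
    -- Cancelling it leaves the parities of the floors.
    gaussSign-floor b a≡1+2b = sign-cancelˡ S (∏-isSign -1^_ [1⋯ h ] -1^-isSign) (begin
      S * gaussSign                                          ≡⟨ cong (_* gaussSign) (∏-↭ -1^_ image-↭) ⟨
      ∏ (map image [1⋯ h ]) -1^_ * gaussSign                 ≡⟨ cong (_* gaussSign) (∏-map -1^_ image [1⋯ h ]) ⟩
      ∏ [1⋯ h ] (λ k → -1^ (image k)) * gaussSign            ≡⟨ ∏-* (λ k → -1^ (image k)) (λ k → -1^ (flips (rem k))) [1⋯ h ] ⟨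
      ∏ [1⋯ h ] (λ k → -1^ (image k) * -1^ (flips (rem k)))  ≡⟨ ∏-cong (All.universal termwise [1⋯ h ]) ⟩
      ∏ [1⋯ h ] (λ k → -1^ k * -1^ ((a ℕ.* k) ℕ./ p))        ≡⟨ ∏-* -1^_ (λ k → -1^ ((a ℕ.* k) ℕ./ p)) [1⋯ h ] ⟩
      S * ∏ [1⋯ h ] (λ k → -1^ ((a ℕ.* k) ℕ./ p))            ∎)
      where
      S = ∏ [1⋯ h ] -1^_
      odd-* : ∀ c m → -1^ (suc (c ℕ.+ c) ℕ.* m) ≡ -1^ m
      odd-* c m = begin
        -1^ (m ℕ.+ (c ℕ.+ c) ℕ.* m)          ≡⟨ cong (λ z → -1^ (m ℕ.+ z)) (ℕ.*-distribʳ-+ m c c) ⟩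
        -1^ (m ℕ.+ (c ℕ.* m ℕ.+ c ℕ.* m))    ≡⟨ -1^-+ m (c ℕ.* m ℕ.+ c ℕ.* m) ⟩
        -1^ m * -1^ (c ℕ.* m ℕ.+ c ℕ.* m)    ≡⟨ cong (-1^ m *_) (-1^-double (c ℕ.* m)) ⟩
        -1^ m * 1ℤ                           ≡⟨ ℤ.*-identityʳ (-1^ m) ⟩
        -1^ m                                ∎
      termwise : ∀ k → -1^ (image k) * -1^ (flips (rem k)) ≡ -1^ k * -1^ ((a ℕ.* k) ℕ./ p)
      termwise k = begin
        -1^ (image k) * -1^ (flips (rem k))  ≡⟨ fold-parity (rem<p k) ⟨
        -1^ (rem k)                          ≡⟨ ℤ.*-identityʳ (-1^ (rem k)) ⟨
        -1^ (rem k) * 1ℤ                     ≡⟨ cong (-1^ (rem k) *_) (-1^-isSign q) ⟨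
        -1^ (rem k) * (-1^ q * -1^ q)        ≡⟨ ℤ.*-assoc (-1^ (rem k)) (-1^ q) (-1^ q) ⟨
        -1^ (rem k) * -1^ q * -1^ q          ≡⟨ cong (_* -1^ q) key ⟨
        -1^ k * -1^ q                        ∎
        where
        q = (a ℕ.* k) ℕ./ p
        key : -1^ k ≡ -1^ (rem k) * -1^ q
        key = begin
          -1^ k                       ≡⟨ odd-* b k ⟨
          -1^ (suc (b ℕ.+ b) ℕ.* k)   ≡⟨ cong (λ z → -1^ (z ℕ.* k)) a≡1+2b ⟨
          -1^ (a ℕ.* k)               ≡⟨ cong -1^_ (ℕ.m≡m%n+[m/n]*n (a ℕ.* k) p) ⟩
          -1^ (rem k ℕ.+ q ℕ.* p)     ≡⟨ -1^-+ (rem k) (q ℕ.* p) ⟩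
          -1^ (rem k) * -1^ (q ℕ.* p) ≡⟨ cong (λ z → -1^ (rem k) * -1^ z) (ℕ.*-comm q p) ⟩
          -1^ (rem k) * -1^ (p ℕ.* q) ≡⟨ cong (-1^ (rem k) *_) (odd-* h q) ⟩
          -1^ (rem k) * -1^ q         ∎

-- The Legendre symbol

-- Replaces the finite search inside `legendre` by statements about all integers t; matching on it
-- also fixes the value of the symbol.
data LegendreView (a : ℤ) (p : ℕ) : ℤ → Set where
  divisible : a ≡ 0ℤ [mod p ] → LegendreView a p 0ℤ
  square    : ∀ t → ¬ a ≡ 0ℤ [mod p ] → a ≡ t * t [mod p ] → LegendreView a p 1ℤ
  nonsquare : ¬ a ≡ 0ℤ [mod p ] → (∀ t → ¬ a ≡ t * t [mod p ]) → LegendreView a p -1ℤ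

residue-≢0 : ∀ a {p r} .{{_ : ℕ.NonZero p}} → a %ℕ p ≡ suc r → ¬ a ≡ 0ℤ [mod p ]
residue-≢0 a {p} a%p≡r a≡0
  with () ← ≡.trans (sym a%p≡r) (mod-small (mod-trans (mod-sym (mod-%ℕ a)) a≡0) (n%ℕd<d a p) (ℕ.>-nonZero⁻¹ p))

legendreView : ∀ a {p} → 3 ℕ.≤ p → LegendreView a p (legendre a p)
legendreView a {suc zero}       (ℕ.s≤s ())
legendreView a {suc (suc zero)} (ℕ.s≤s (ℕ.s≤s ()))
legendreView a {p@(suc (suc (suc _)))} _ with a %ℕ p in a%p≡r
... | zero = divisible (mod-trans (mod-%ℕ a) (≡⇒mod (cong +_ a%p≡r)))
... | suc r with any (λ t → ⌊ (t ℕ.* t) ℕ.% p ℕ.≟ suc r ⌋) (upTo p) in found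
             | residue-≢0 a a%p≡r | mod-trans (mod-%ℕ a) (≡⇒mod {p} (cong +_ a%p≡r))
...   | true | a≢0 | a≡r = square (+ t) a≢0 (mod-trans a≡r (mod-trans (≡⇒mod (cong +_ (sym t²%p≡r)))
                             (mod-trans (mod-sym (mod-%ℕ (+ (t ℕ.* t)))) (≡⇒mod (ℤ.pos-* t t)))))
  where
  witness : ∃ λ t → T ⌊ (t ℕ.* t) ℕ.% p ℕ.≟ suc r ⌋
  witness = Any.satisfied (any⁻ (λ t → ⌊ (t ℕ.* t) ℕ.% p ℕ.≟ suc r ⌋) (upTo p) (subst T (sym found) tt))
  t = proj₁ witness
  t²%p≡r : (t ℕ.* t) ℕ.% p ≡ suc r
  t²%p≡r = toWitness (proj₂ witness)
-- A square root t of a would have been found by the search at the residue of t modulo p.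
...   | false | a≢0 | a≡r = nonsquare a≢0 λ t a≡t² → subst T found
  (any⁺ (λ t → ⌊ (t ℕ.* t) ℕ.% p ℕ.≟ suc r ⌋) (lose (∈-upTo⁺ (n%ℕd<d t p)) (fromWitness (square-rem t a≡t²))))
  where
  square-rem : ∀ t → a ≡ t * t [mod p ] → ((t %ℕ p) ℕ.* (t %ℕ p)) ℕ.% p ≡ suc r
  square-rem t a≡t² = mod-small
    (mod-trans (mod-sym (mod-%ℕ (+ (u ℕ.* u))))
    (mod-trans (≡⇒mod (ℤ.pos-* u u))
    (mod-trans (mod-* (mod-sym (mod-%ℕ t)) (mod-sym (mod-%ℕ t)))
    (mod-trans (mod-sym a≡t²) a≡r)))) (ℕ.m%n<n (u ℕ.* u) p) (subst (ℕ._< p) a%p≡r (n%ℕd<d a p))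
    where u = t %ℕ p

^-distrib-* : ∀ a b n → (a * b) ^ n ≡ a ^ n * b ^ n
^-distrib-* a b zero    = ≡.refl
^-distrib-* a b (suc n) = ≡.trans (cong (a * b *_) (^-distrib-* a b n)) (interchange a b (a ^ n) (b ^ n))

module Legendre (h : ℕ) (prime : Prime (suc (h ℕ.+ h))) where

  open HalfSystem h prime

  1≤h : 1 ℕ.≤ h
  1≤h = positive h prime
    where
    positive : ∀ m → Prime (suc (m ℕ.+ m)) → 1 ℕ.≤ m
    positive zero    prime[1] = contradiction (prime⇒nonTrivial prime[1]) λ ()
    positive (suc _) _        = ℕ.s≤s ℕ.z≤n

  3≤p : 3 ℕ.≤ p
  3≤p = ℕ.s≤s (ℕ.+-mono-≤ 1≤h 1≤h)

  abstract
    -- Gauss's lemma for the residue of a supplies the sign; its square being 1 gives (t²)^h ≡ 1 in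
    -- `square^h`.
    power-isSign : ∀ a → ¬ a ≡ 0ℤ [mod p ] → ∃ λ s → IsSign s × a ^ h ≡ s [mod p ]
    power-isSign a a≢0 = gaussSign b b≢0 , gaussSign-isSign b b≢0 , mod-trans (mod-^ h a≡b) (gaussLemma b b≢0)
      where
      b : ℕ
      b = a %ℕ p
      a≡b : a ≡ + b [mod p ]
      a≡b = mod-%ℕ a
      b≢0 : ¬ + b ≡ 0ℤ [mod p ]
      b≢0 = a≢0 ∘ mod-trans a≡b

  square^h : ∀ t → ¬ t ≡ 0ℤ [mod p ] → (t * t) ^ h ≡ 1ℤ [mod p ]
  square^h t t≢0 with s , ss , tʰ≡s ← power-isSign t t≢0 =
    mod-trans (≡⇒mod (^-distrib-* t t h)) (mod-trans (mod-* tʰ≡s tʰ≡s) (≡⇒mod ss))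

  -- The squares of 1, …, h already exhaust the h roots of xʰ - 1.
  nonsquare^h : ∀ a → (∀ t → ¬ a ≡ t * t [mod p ]) → ¬ a ^ h ≡ 1ℤ [mod p ]
  nonsquare^h a a≢t² aʰ≡1 = tooManyRootsOfUnity prime h 1≤h (a ∷ map (λ k → + k * + k) [1⋯ h ])
    (All.map⁺ (All.universal (λ k → a≢t² (+ k)) [1⋯ h ]) ∷
     AllPairs.map⁺ (AllPairs-[1⋯] h squares-injective))
    (aʰ≡1 ∷ All.map⁺ (All-[1⋯] h λ {k} 1≤k k≤h → square^h (+ k) (≢0 1≤k (≤h⇒<p k≤h))))
    (cong suc (≡.trans (length-map (λ k → + k * + k) [1⋯ h ]) (length-applyDownFrom suc h)))

  0^h≡0 : 0ℤ ^ h ≡ 0ℤ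
  0^h≡0 = zero-power 1≤h
    where
    zero-power : ∀ {n} → 1 ℕ.≤ n → 0ℤ ^ n ≡ 0ℤ
    zero-power {suc _} _ = ≡.refl

  -- For a nonsquare the power is ±1 by `power-isSign`, and +1 is excluded by the count of roots in
  -- `nonsquare^h`.
  eulerCriterion : ∀ a → a ^ h ≡ legendre a p [mod p ]
  eulerCriterion a with legendre a p | legendreView a 3≤p
  ... | _ | divisible a≡0 = mod-trans (mod-^ h a≡0) (≡⇒mod 0^h≡0)
  ... | _ | square t a≢0 a≡t² = mod-trans (mod-^ h a≡t²)
    (square^h t λ t≡0 → a≢0 (mod-trans a≡t² (mod-* t≡0 t≡0)))
  ... | _ | nonsquare a≢0 a≢t² with power-isSign a a≢0
  ...   | s , ss , aʰ≡s with isSign⇒±1 s ss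
  ...     | inj₁ ≡.refl = contradiction aʰ≡s (nonsquare^h a a≢t²)
  ...     | inj₂ ≡.refl = aʰ≡s

  ∣legendre∣≤1 : ∀ a → ∣ legendre a p ∣ ℕ.≤ 1
  ∣legendre∣≤1 a with legendre a p | legendreView a 3≤p
  ... | _ | divisible _     = ℕ.z≤n
  ... | _ | square _ _ _    = ℕ.≤-refl
  ... | _ | nonsquare _ _   = ℕ.≤-refl

  -- Two values among -1, 0, 1 differ by at most 2 < p, so Euler's criterion determines the symbol
  -- exactly. The algebraic rules for the symbol below follow from this.
  legendre-unique : ∀ a v → ∣ v ∣ ℕ.≤ 1 → a ^ h ≡ v [mod p ] → legendre a p ≡ v
  legendre-unique a v ∣v∣≤1 aʰ≡v = mod-close (mod-trans (mod-sym (eulerCriterion a)) aʰ≡v)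
    (ℕ.≤-<-trans (ℤ.∣i-j∣≤∣i∣+∣j∣ (legendre a p) v)
      (ℕ.≤-trans (ℕ.s≤s (ℕ.+-mono-≤ (∣legendre∣≤1 a) ∣v∣≤1)) 3≤p))

  legendre-mod : ∀ {a b} → a ≡ b [mod p ] → legendre a p ≡ legendre b p
  legendre-mod {a} {b} a≡b = legendre-unique a (legendre b p) (∣legendre∣≤1 b)
    (mod-trans (mod-^ h a≡b) (eulerCriterion b))

  legendre-* : ∀ a b → legendre (a * b) p ≡ legendre a p * legendre b p
  legendre-* a b = legendre-unique (a * b) (legendre a p * legendre b p)
    (subst (ℕ._≤ 1) (sym (ℤ.abs-* (legendre a p) (legendre b p))) (ℕ.*-mono-≤ (∣legendre∣≤1 a) (∣legendre∣≤1 b)))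
    (mod-trans (≡⇒mod (^-distrib-* a b h)) (mod-* (eulerCriterion a) (eulerCriterion b)))

  isSign⇒∣∣≤1 : ∀ s → IsSign s → ∣ s ∣ ℕ.≤ 1
  isSign⇒∣∣≤1 s ss with isSign⇒±1 s ss
  ... | inj₁ ≡.refl = ℕ.≤-refl
  ... | inj₂ ≡.refl = ℕ.≤-refl

  legendre-1 : legendre 1ℤ p ≡ 1ℤ
  legendre-1 = legendre-unique 1ℤ 1ℤ ℕ.≤-refl (≡⇒mod (ℤ.^-zeroˡ h))

  legendre--1 : legendre -1ℤ p ≡ -1^ h
  legendre--1 = legendre-unique -1ℤ (-1^ h) (isSign⇒∣∣≤1 (-1^ h) (-1^-isSign h)) (≡⇒mod ≡.refl)

  legendre-self : legendre (+ p) p ≡ 0ℤ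
  legendre-self = legendre-unique (+ p) 0ℤ ℕ.z≤n
    (mod-trans (mod-^ h (∣⇒mod0 (+ p) ℕ.∣-refl)) (≡⇒mod 0^h≡0))

  legendre-floor : ∀ b → ¬ + suc (b ℕ.+ b) ≡ 0ℤ [mod p ] →
    legendre (+ suc (b ℕ.+ b)) p ≡ ∏ [1⋯ h ] (λ k → -1^ ((suc (b ℕ.+ b) ℕ.* k) ℕ./ p))
  legendre-floor b a≢0 = ≡.trans
    (legendre-unique (+ a) (gaussSign a a≢0) (isSign⇒∣∣≤1 (gaussSign a a≢0) (gaussSign-isSign a a≢0)) (gaussLemma a a≢0))
    (gaussSign-floor a a≢0 b ≡.refl)
    where a = suc (b ℕ.+ b)

-- Reciprocity for odd primes

-- Writes (-1)^m as a product over a range of l that does not depend on m. For m = ⌊q k / p⌋ the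
-- factors -1 mark the lattice points of column k below the diagonal.
stepSign : ℕ → ℕ → ℤ
stepSign m l with l ℕ.≤? m
... | yes _ = -1ℤ
... | no  _ = 1ℤ

∏-stepSign-≤ : ∀ {m} n → n ℕ.≤ m → ∏ [1⋯ n ] (stepSign m) ≡ -1^ n
∏-stepSign-≤     zero    _   = ≡.refl
∏-stepSign-≤ {m} (suc n) n<m with suc n ℕ.≤? m
... | yes _   = cong (-1ℤ *_) (∏-stepSign-≤ n (ℕ.<⇒≤ n<m))
... | no  n≮m = contradiction n<m n≮m

∏-stepSign : ∀ {m} n → m ℕ.≤ n → ∏ [1⋯ n ] (stepSign m) ≡ -1^ m
∏-stepSign {m} n m≤n with ℕ.m≤n⇒m<n∨m≡n m≤n
... | inj₂ ≡.refl = ∏-stepSign-≤ n ℕ.≤-refl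
∏-stepSign {m} (suc n) _ | inj₁ (ℕ.s≤s m≤n) with suc n ℕ.≤? m
... | yes n<m = contradiction m≤n (ℕ.<⇒≱ n<m)
... | no  _   = ≡.trans (ℤ.*-identityˡ _) (∏-stepSign n m≤n)

≤/⇒*≤ : ∀ l x p .{{_ : ℕ.NonZero p}} → l ℕ.≤ x ℕ./ p → l ℕ.* p ℕ.≤ x
≤/⇒*≤ l x p l≤x/p = ℕ.≤-trans (ℕ.*-monoˡ-≤ p l≤x/p) (ℕ.m/n*n≤m x p)

*≤⇒≤/ : ∀ l x p .{{_ : ℕ.NonZero p}} → l ℕ.* p ℕ.≤ x → l ℕ.≤ x ℕ./ p
*≤⇒≤/ l x p lp≤x = subst (ℕ._≤ x ℕ./ p) (ℕ.m*n/n≡m l p) (ℕ./-monoˡ-≤ p lp≤x)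

module Reciprocity (h i : ℕ) (prime-p : Prime (suc (h ℕ.+ h))) (prime-q : Prime (suc (i ℕ.+ i))) where

  p = suc (h ℕ.+ h)
  q = suc (i ℕ.+ i)
  module P = Legendre h prime-p
  module Q = Legendre i prime-q

  distinct⇒≢0 : ∀ {m n} → Prime m → Prime n → m ≢ n → ¬ + n ≡ 0ℤ [mod m ]
  distinct⇒≢0 {m} prime-m prime-n m≢n n≡0 with prime⇒irreducible prime-n (mod0⇒∣ n≡0)
  ... | inj₁ ≡.refl = contradiction (prime⇒nonTrivial prime-m) λ ()
  ... | inj₂ m≡n    = m≢n m≡n

  module _ (p≢q : p ≢ q) where

    -- Otherwise p would divide q, a different prime, or k, which lies strictly between 0 and p.
    no-lattice-point : ∀ {k l} → 1 ℕ.≤ k → k ℕ.≤ h → ¬ l ℕ.* p ≡ q ℕ.* k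
    no-lattice-point {k} {l} 1≤k k≤h lp≡qk
      with mod-euclid prime-p (+ q) (+ k) (mod-trans (≡⇒mod (sym (ℤ.pos-* q k))) (∣⇒mod0 (+ (q ℕ.* k)) (ℕ.divides l (sym lp≡qk))))
    ... | inj₁ q≡0 = distinct⇒≢0 prime-p prime-q p≢q q≡0
    ... | inj₂ k≡0 = HalfSystem.≢0 h prime-p 1≤k (HalfSystem.≤h⇒<p h prime-p k≤h) k≡0

    -- Exactly one of l p ≤ q k and k q ≤ p l holds.
    either-side : ∀ {k l} → 1 ℕ.≤ k → k ℕ.≤ h →
      stepSign ((q ℕ.* k) ℕ./ p) l * stepSign ((p ℕ.* l) ℕ./ q) k ≡ -1ℤ
    either-side {k} {l} 1≤k k≤h with l ℕ.≤? (q ℕ.* k) ℕ./ p | k ℕ.≤? (p ℕ.* l) ℕ./ q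
    ... | yes _ | no  _ = ≡.refl
    ... | no  _ | yes _ = ≡.refl
    ... | yes a | yes b = contradiction
      (ℕ.≤-antisym (≤/⇒*≤ l (q ℕ.* k) p a) (≡.subst₂ ℕ._≤_ (ℕ.*-comm k q) (ℕ.*-comm p l) (≤/⇒*≤ k (p ℕ.* l) q b)))
      (no-lattice-point {k} {l} 1≤k k≤h)
    ... | no  a | no  b with ℕ.≤-total (l ℕ.* p) (q ℕ.* k)
    ...   | inj₁ lp≤qk = contradiction (*≤⇒≤/ l (q ℕ.* k) p lp≤qk) a
    ...   | inj₂ qk≤lp = contradiction (*≤⇒≤/ k (p ℕ.* l) q (≡.subst₂ ℕ._≤_ (ℕ.*-comm q k) (ℕ.*-comm l p) qk≤lp)) b

  -- (2n+1) k ≤ (2n+1) m < (n+1)(2m+1), so each column below the diagonal stays inside the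
  -- rectangle.
  floor-bound : ∀ m n {k} → k ℕ.≤ m → (suc (n ℕ.+ n) ℕ.* k) ℕ./ suc (m ℕ.+ m) ℕ.≤ n
  floor-bound m n {k} k≤m = ℕ.s≤s⁻¹ (ℕ.m<n*o⇒m/o<n (ℕ.≤-<-trans (ℕ.*-monoʳ-≤ (suc (n ℕ.+ n)) k≤m)
    (subst (suc (n ℕ.+ n) ℕ.* m ℕ.<_) (gap m n) (ℕ.m<m+n (suc (n ℕ.+ n) ℕ.* m) ℕ.z<s))))
    where
    gap : ∀ m n → suc (n ℕ.+ n) ℕ.* m ℕ.+ suc (m ℕ.+ n) ≡ suc n ℕ.* suc (m ℕ.+ m)
    gap = solveℕ-∀

  -- For p = q both symbols vanish. Otherwise `L` and `M` count the points of the h by i rectangle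
  -- on the two sides of the diagonal, so `L * M` is (-1)^(h i), and M² = 1 moves `M` across.
  reciprocity : legendre (+ q) p ≡ -1^ (h ℕ.* i) * legendre (+ p) q
  reciprocity with h ℕ.≟ i
  ... | yes ≡.refl = ≡.trans P.legendre-self (sym (≡.trans (cong (-1^ (h ℕ.* h) *_) P.legendre-self) (ℤ.*-zeroʳ (-1^ (h ℕ.* h)))))
  ... | no  h≢i = begin
    legendre (+ q) p                    ≡⟨ P.legendre-floor i (distinct⇒≢0 prime-p prime-q p≢q) ⟩
    L                                   ≡⟨ ℤ.*-identityʳ L ⟨
    L * 1ℤ                              ≡⟨ cong (L *_) (∏-isSign (λ l → -1^ ((p ℕ.* l) ℕ./ q)) [1⋯ i ] (λ l → -1^-isSign ((p ℕ.* l) ℕ./ q))) ⟨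
    L * (M * M)                         ≡⟨ ℤ.*-assoc L M M ⟨
    L * M * M                           ≡⟨ cong₂ _*_ L*M (sym (Q.legendre-floor h (distinct⇒≢0 prime-q prime-p (p≢q ∘ sym)))) ⟩
    -1^ (h ℕ.* i) * legendre (+ p) q    ∎
    where
    p≢q : p ≢ q
    p≢q p≡q = h≢i (≡.trans (ℕ.n≡⌊n+n/2⌋ h) (≡.trans (cong ℕ.⌊_/2⌋ (ℕ.suc-injective p≡q)) (sym (ℕ.n≡⌊n+n/2⌋ i))))
    L = ∏ [1⋯ h ] (λ k → -1^ ((q ℕ.* k) ℕ./ p))
    M = ∏ [1⋯ i ] (λ l → -1^ ((p ℕ.* l) ℕ./ q))
    below above : ℕ → ℕ → ℤ
    below k l = stepSign ((q ℕ.* k) ℕ./ p) l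
    above k l = stepSign ((p ℕ.* l) ℕ./ q) k
    L*M : L * M ≡ -1^ (h ℕ.* i)
    L*M = begin
      L * M
        ≡⟨ cong₂ _*_
             (∏-cong (All-[1⋯] h λ {k} _ k≤h → sym (∏-stepSign i (floor-bound h i {k} k≤h))))
             (∏-cong (All-[1⋯] i λ {l} _ l≤i → sym (∏-stepSign h (floor-bound i h {l} l≤i)))) ⟩
      ∏ [1⋯ h ] (λ k → ∏ [1⋯ i ] (below k)) * ∏ [1⋯ i ] (λ l → ∏ [1⋯ h ] (λ k → above k l))
        ≡⟨ cong (∏ [1⋯ h ] (λ k → ∏ [1⋯ i ] (below k)) *_) (∏-swap above [1⋯ h ] [1⋯ i ]) ⟨
      ∏ [1⋯ h ] (λ k → ∏ [1⋯ i ] (below k)) * ∏ [1⋯ h ] (λ k → ∏ [1⋯ i ] (above k))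
        ≡⟨ ∏-* (λ k → ∏ [1⋯ i ] (below k)) (λ k → ∏ [1⋯ i ] (above k)) [1⋯ h ] ⟨
      ∏ [1⋯ h ] (λ k → ∏ [1⋯ i ] (below k) * ∏ [1⋯ i ] (above k))
        ≡⟨ ∏-cong (All-[1⋯] h λ {k} 1≤k k≤h → column k 1≤k k≤h) ⟩
      ∏ [1⋯ h ] (λ _ → -1^ i)
        ≡⟨ ∏-const (-1^ i) [1⋯ h ] ⟩
      (-1^ i) ^ length [1⋯ h ]
        ≡⟨ cong ((-1^ i) ^_) (length-applyDownFrom suc h) ⟩
      (-1^ i) ^ h
        ≡⟨ ℤ.^-*-assoc -1ℤ i h ⟩
      -1^ (i ℕ.* h)
        ≡⟨ cong -1^_ (ℕ.*-comm i h) ⟩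
      -1^ (h ℕ.* i) ∎
      where
      column : ∀ k → 1 ℕ.≤ k → k ℕ.≤ h → ∏ [1⋯ i ] (below k) * ∏ [1⋯ i ] (above k) ≡ -1^ i
      column k 1≤k k≤h = begin
        ∏ [1⋯ i ] (below k) * ∏ [1⋯ i ] (above k)  ≡⟨ ∏-* (below k) (above k) [1⋯ i ] ⟨
        ∏ [1⋯ i ] (λ l → below k l * above k l)    ≡⟨ ∏-cong (All.universal (λ l → either-side p≢q {k} {l} 1≤k k≤h) [1⋯ i ]) ⟩
        ∏ [1⋯ i ] (λ _ → -1ℤ)                      ≡⟨ ∏-const -1ℤ [1⋯ i ] ⟩
        -1ℤ ^ length [1⋯ i ]                       ≡⟨ cong -1^_ (length-applyDownFrom suc i) ⟩
        -1^ i                                      ∎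

-- Parity

Odd : ℕ → Set
Odd n = ∃ λ h → n ≡ suc (h ℕ.+ h)

even⊎odd : ∀ n → (∃ λ h → n ≡ h ℕ.+ h) ⊎ Odd n
even⊎odd zero = inj₁ (0 , ≡.refl)
even⊎odd (suc n) with even⊎odd n
... | inj₁ (h , n≡2h)   = inj₂ (h , cong suc n≡2h)
... | inj₂ (h , n≡1+2h) = inj₁ (suc h , cong suc (≡.trans n≡1+2h (sym (ℕ.+-suc h h))))

¬even×odd : ∀ h i → h ℕ.+ h ≢ suc (i ℕ.+ i)
¬even×odd (suc h) (suc i) e = ¬even×odd h i (ℕ.suc-injective (≡.trans (sym (ℕ.+-suc h h))
  (≡.trans (ℕ.suc-injective e) (cong suc (ℕ.+-suc i i)))))
¬even×odd (suc h) zero    e with () ← ≡.trans (sym (ℕ.+-suc h h)) (ℕ.suc-injective e)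

odd-*ˡ : ∀ m n → Odd (m ℕ.* n) → Odd m
odd-*ˡ m n (i , mn≡1+2i) with even⊎odd m
... | inj₂ odd          = odd
... | inj₁ (h , ≡.refl) = contradiction (≡.trans (sym (ℕ.*-distribʳ-+ n h h)) mn≡1+2i) (¬even×odd (h ℕ.* n) i)

odd-*ʳ : ∀ m n → Odd (m ℕ.* n) → Odd n
odd-*ʳ m n = odd-*ˡ n m ∘ subst Odd (ℕ.*-comm m n)

half-odd : ∀ h → ⌊ suc (h ℕ.+ h) /2⌋ ≡ h
half-odd zero    = ≡.refl
half-odd (suc h) = cong suc (≡.trans (cong ⌊_/2⌋ (ℕ.+-suc h h)) (half-odd h))

odd-*-odd : ∀ h i → suc (h ℕ.+ h) ℕ.* suc (i ℕ.+ i) ≡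
  suc (h ℕ.* i ℕ.+ h ℕ.* i ℕ.+ (h ℕ.+ i) ℕ.+ (h ℕ.* i ℕ.+ h ℕ.* i ℕ.+ (h ℕ.+ i)))
odd-*-odd = solveℕ-∀

-- On odd n, the nontrivial character modulo 4.
χ : ℕ → ℤ
χ n = -1^ ⌊ n /2⌋

-- The half of (2h+1)(2i+1) - 1 is 2hi + h + i, which has the parity of h + i.
χ-* : ∀ {m n} → Odd m → Odd n → χ (m ℕ.* n) ≡ χ m * χ n
χ-* (h , ≡.refl) (i , ≡.refl) = begin
  -1^ ⌊ suc (h ℕ.+ h) ℕ.* suc (i ℕ.+ i) /2⌋  ≡⟨ cong (λ z → -1^ ⌊ z /2⌋) (odd-*-odd h i) ⟩
  -1^ ⌊ suc (j ℕ.+ j) /2⌋                    ≡⟨ cong -1^_ (half-odd j) ⟩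
  -1^ (hi ℕ.+ hi ℕ.+ (h ℕ.+ i))              ≡⟨ -1^-+ (hi ℕ.+ hi) (h ℕ.+ i) ⟩
  -1^ (hi ℕ.+ hi) * -1^ (h ℕ.+ i)            ≡⟨ cong (_* -1^ (h ℕ.+ i)) (-1^-double hi) ⟩
  1ℤ * -1^ (h ℕ.+ i)                         ≡⟨ ℤ.*-identityˡ _ ⟩
  -1^ (h ℕ.+ i)                              ≡⟨ -1^-+ h i ⟩
  -1^ h * -1^ i                              ≡⟨ cong₂ (λ a b → -1^ a * -1^ b) (half-odd h) (half-odd i) ⟨
  χ (suc (h ℕ.+ h)) * χ (suc (i ℕ.+ i))      ∎
  where
  hi = h ℕ.* i
  j = hi ℕ.+ hi ℕ.+ (h ℕ.+ i)

-- On odd m and n, the sign in the law of quadratic reciprocity: half of m - 1 times half of n - 1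
-- as exponent.
ε : ℕ → ℕ → ℤ
ε m n = -1^ (⌊ m /2⌋ ℕ.* ⌊ n /2⌋)

ε-χ : ∀ m n → ε m n ≡ χ m ^ ⌊ n /2⌋
ε-χ m n = sym (ℤ.^-*-assoc -1ℤ ⌊ m /2⌋ ⌊ n /2⌋)

ε-comm : ∀ m n → ε m n ≡ ε n m
ε-comm m n = cong -1^_ (ℕ.*-comm ⌊ m /2⌋ ⌊ n /2⌋)

ε-*ˡ : ∀ {m n} k → Odd m → Odd n → ε (m ℕ.* n) k ≡ ε m k * ε n k
ε-*ˡ {m} {n} k odd-m odd-n = begin
  ε (m ℕ.* n) k                       ≡⟨ ε-χ (m ℕ.* n) k ⟩
  χ (m ℕ.* n) ^ ⌊ k /2⌋               ≡⟨ cong (_^ ⌊ k /2⌋) (χ-* odd-m odd-n) ⟩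
  (χ m * χ n) ^ ⌊ k /2⌋               ≡⟨ ^-distrib-* (χ m) (χ n) ⌊ k /2⌋ ⟩
  χ m ^ ⌊ k /2⌋ * χ n ^ ⌊ k /2⌋       ≡⟨ cong₂ _*_ (ε-χ m k) (ε-χ n k) ⟨
  ε m k * ε n k                       ∎

ε-*ʳ : ∀ k {m n} → Odd m → Odd n → ε k (m ℕ.* n) ≡ ε k m * ε k n
ε-*ʳ k {m} {n} odd-m odd-n = ≡.trans (ε-comm k (m ℕ.* n))
  (≡.trans (ε-*ˡ k odd-m odd-n) (cong₂ _*_ (ε-comm m k) (ε-comm n k)))

-- The Jacobi symbol

IsOddPrime : ℕ → Set
IsOddPrime p = Odd p × Prime p

oddPrimes : ∀ ps → All Prime ps → Odd (product ps) → All IsOddPrime ps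
oddPrimes []       []       _   = []
oddPrimes (p ∷ ps) (pr ∷ prs) odd =
  (odd-*ˡ p (product ps) odd , pr) ∷ oddPrimes ps prs (odd-*ʳ p (product ps) odd)

odd-product : ∀ {ps} → All IsOddPrime ps → Odd (product ps)
odd-product [] = 0 , ≡.refl
odd-product {p ∷ ps} (((h , p≡) , _) ∷ ops) with i , P≡ ← odd-product ops =
  h ℕ.* i ℕ.+ h ℕ.* i ℕ.+ (h ℕ.+ i) , ≡.trans (cong₂ ℕ._*_ p≡ P≡) (odd-*-odd h i)

-- The denominator is given by its prime factors, which allows induction. At the list from
-- `factorise` this is definitionally `kronecker` with a positive denominator.
jacobi : ℤ → List ℕ → ℤ
jacobi a ps = ∏ ps (legendre a)

jacobi-* : ∀ a b {ps} → All IsOddPrime ps → jacobi (a * b) ps ≡ jacobi a ps * jacobi b ps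
jacobi-* a b {ps} ops = ≡.trans
  (∏-cong {f = legendre (a * b)} {λ p → legendre a p * legendre b p}
    (All.map (λ { ((h , ≡.refl) , pr) → Legendre.legendre-* h pr a b }) ops))
  (∏-* (legendre a) (legendre b) ps)

jacobi-1 : ∀ {ps} → All IsOddPrime ps → jacobi 1ℤ ps ≡ 1ℤ
jacobi-1 {ps} ops = begin
  ∏ ps (legendre 1ℤ) ≡⟨ ∏-cong {f = legendre 1ℤ} {λ _ → 1ℤ} (All.map (λ { ((h , ≡.refl) , pr) → Legendre.legendre-1 h pr }) ops) ⟩
  ∏ ps (λ _ → 1ℤ)    ≡⟨ ∏-const 1ℤ ps ⟩
  1ℤ ^ length ps     ≡⟨ ℤ.^-zeroˡ (length ps) ⟩
  1ℤ                 ∎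

jacobi--1 : ∀ {ps} → All IsOddPrime ps → jacobi -1ℤ ps ≡ χ (product ps)
jacobi--1 [] = ≡.refl
jacobi--1 {p ∷ ps} (((h , ≡.refl) , pr) ∷ ops) = begin
  legendre -1ℤ p * jacobi -1ℤ ps ≡⟨ cong₂ _*_ (Legendre.legendre--1 h pr) (jacobi--1 ops) ⟩
  -1^ h * χ (product ps)         ≡⟨ cong (λ z → -1^ z * χ (product ps)) (half-odd h) ⟨
  χ p * χ (product ps)           ≡⟨ χ-* (h , ≡.refl) (odd-product ops) ⟨
  χ (p ℕ.* product ps)           ∎

jacobi-mod : ∀ {a b ps} → All IsOddPrime ps → a ≡ b [mod product ps ] → jacobi a ps ≡ jacobi b ps
jacobi-mod [] _ = ≡.refl
jacobi-mod {a} {b} {p ∷ ps} (((h , ≡.refl) , pr) ∷ ops) a≡b = cong₂ _*_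
  (Legendre.legendre-mod h pr {a} {b} (∣⇒mod a b (ℕ.∣-trans (ℕ.m∣m*n (product ps)) (mod⇒∣ a≡b))))
  (jacobi-mod ops (∣⇒mod a b (ℕ.∣-trans (ℕ.n∣m*n p) (mod⇒∣ a≡b))))

-- Both sides are multiplicative in the product of qs, so reciprocity of primes extends by
-- induction; `jacobi-reciprocity` repeats this in the other entry.
legendre-product : ∀ {p qs} → IsOddPrime p → All IsOddPrime qs →
  legendre (+ product qs) p ≡ ε p (product qs) * jacobi (+ p) qs
legendre-product {p} ((h , ≡.refl) , pr) [] = ≡.trans (Legendre.legendre-1 h pr)
  (sym (cong (λ z → -1^ z * 1ℤ) (ℕ.*-zeroʳ ⌊ p /2⌋)))
legendre-product {p} {q ∷ qs} op@((h , ≡.refl) , pr) (oq@((i , ≡.refl) , pr′) ∷ oqs) = begin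
  legendre (+ (q ℕ.* Q)) p                                  ≡⟨ cong (λ z → legendre z p) (ℤ.pos-* q Q) ⟩
  legendre (+ q * + Q) p                                    ≡⟨ Legendre.legendre-* h pr (+ q) (+ Q) ⟩
  legendre (+ q) p * legendre (+ Q) p                       ≡⟨ cong₂ _*_ (Reciprocity.reciprocity h i pr pr′) (legendre-product op oqs) ⟩
  -1^ (h ℕ.* i) * legendre (+ p) q * (ε p Q * jacobi (+ p) qs) ≡⟨ cong (λ z → z * legendre (+ p) q * (ε p Q * jacobi (+ p) qs)) ε-pq ⟩
  ε p q * legendre (+ p) q * (ε p Q * jacobi (+ p) qs)      ≡⟨ interchange (ε p q) (legendre (+ p) q) (ε p Q) (jacobi (+ p) qs) ⟩
  ε p q * ε p Q * (legendre (+ p) q * jacobi (+ p) qs)      ≡⟨ cong (_* (legendre (+ p) q * jacobi (+ p) qs)) (ε-*ʳ p (i , ≡.refl) (odd-product oqs)) ⟨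
  ε p (q ℕ.* Q) * (legendre (+ p) q * jacobi (+ p) qs)      ∎
  where
  Q = product qs
  ε-pq : -1^ (h ℕ.* i) ≡ ε p q
  ε-pq = cong₂ (λ a b → -1^ (a ℕ.* b)) (sym (half-odd h)) (sym (half-odd i))

jacobi-reciprocity : ∀ {ps qs} → All IsOddPrime ps → All IsOddPrime qs →
  jacobi (+ product qs) ps ≡ ε (product ps) (product qs) * jacobi (+ product ps) qs
jacobi-reciprocity [] oqs = sym (≡.trans (ℤ.*-identityˡ _) (jacobi-1 oqs))
jacobi-reciprocity {p ∷ ps} {qs} (op@(odd-p , _) ∷ ops) oqs = begin
  legendre (+ Q) p * jacobi (+ Q) ps                        ≡⟨ cong₂ _*_ (legendre-product op oqs) (jacobi-reciprocity ops oqs) ⟩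
  ε p Q * jacobi (+ p) qs * (ε P Q * jacobi (+ P) qs)       ≡⟨ interchange (ε p Q) (jacobi (+ p) qs) (ε P Q) (jacobi (+ P) qs) ⟩
  ε p Q * ε P Q * (jacobi (+ p) qs * jacobi (+ P) qs)       ≡⟨ cong₂ _*_ (ε-*ˡ Q odd-p (odd-product ops)) (jacobi-* (+ p) (+ P) oqs) ⟨
  ε (p ℕ.* P) Q * jacobi (+ p * + P) qs                     ≡⟨ cong (λ z → ε (p ℕ.* P) Q * jacobi z qs) (ℤ.pos-* p P) ⟨
  ε (p ℕ.* P) Q * jacobi (+ (p ℕ.* P)) qs                   ∎
  where
  P = product ps
  Q = product qs

-- The Kronecker symbol of an odd denominator

factorisation-odd : ∀ {n} → Odd (suc n) → All IsOddPrime (factors (factorise (suc n)))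
factorisation-odd {n} odd = oddPrimes _ (PrimeFactorisation.factorsPrime (factorise (suc n)))
  (subst Odd (PrimeFactorisation.isFactorisation (factorise (suc n))) odd)

module _ {n : ℕ} (odd-n : Odd (suc n)) where

  private
    ps  = factors (factorise (suc n))
    ops = factorisation-odd odd-n
    n≡ : suc n ≡ product ps
    n≡ = PrimeFactorisation.isFactorisation (factorise (suc n))

  kronecker-mod : ∀ {a b} → a ≡ b [mod suc n ] → kronecker a (+ suc n) ≡ kronecker b (+ suc n)
  kronecker-mod {a} {b} a≡b = jacobi-mod ops (subst (λ m → a ≡ b [mod m ]) n≡ a≡b)

  kronecker-neg : ∀ m → kronecker -[1+ m ] (+ suc n) ≡ χ (suc n) * kronecker (+ suc m) (+ suc n)
  kronecker-neg m = begin
    jacobi -[1+ m ] ps                      ≡⟨ cong (λ z → jacobi z ps) (ℤ.-1*i≡-i (+ suc m)) ⟨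
    jacobi (-1ℤ * + suc m) ps               ≡⟨ jacobi-* -1ℤ (+ suc m) ops ⟩
    jacobi -1ℤ ps * jacobi (+ suc m) ps     ≡⟨ cong (_* jacobi (+ suc m) ps) (jacobi--1 ops) ⟩
    χ (product ps) * jacobi (+ suc m) ps    ≡⟨ cong (λ z → χ z * jacobi (+ suc m) ps) n≡ ⟨
    χ (suc n) * jacobi (+ suc m) ps         ∎

  kronecker-reciprocity : ∀ {m} → Odd (suc m) →
    kronecker (+ suc m) (+ suc n) ≡ ε (suc n) (suc m) * kronecker (+ suc n) (+ suc m)
  kronecker-reciprocity {m} odd-m = begin
    jacobi (+ suc m) ps                              ≡⟨ cong (λ z → jacobi (+ z) ps) m≡ ⟩
    jacobi (+ product qs) ps                         ≡⟨ jacobi-reciprocity ops (factorisation-odd odd-m) ⟩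
    ε (product ps) (product qs) * jacobi (+ product ps) qs ≡⟨ cong₂ (λ a b → ε a b * jacobi (+ a) qs) n≡ m≡ ⟨
    ε (suc n) (suc m) * jacobi (+ suc n) qs          ∎
    where
    qs = factors (factorise (suc m))
    m≡ : suc m ≡ product qs
    m≡ = PrimeFactorisation.isFactorisation (factorise (suc m))

square≢-1 : ∀ a → a * a ≢ -1ℤ
square≢-1 (+ m)    e with () ← ≡.trans (ℤ.pos-* m m) e
square≢-1 -[1+ m ] ()

-- By unique factorisation the prime factors of a square are those of its root taken twice, so the
-- symbol is itself an integer square.
kronecker-square≢-1 : ∀ a t → kronecker a (+ (suc t ℕ.* suc t)) ≢ -1ℤ
kronecker-square≢-1 a t e = square≢-1 (jacobi a ps) (begin
  jacobi a ps * jacobi a ps                              ≡⟨ ∏-++ (legendre a) ps ps ⟨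
  jacobi a (ps ++ ps)                                    ≡⟨ ∏-↭ (legendre a) (factorisationUnique doubled (factorise (suc t ℕ.* suc t))) ⟩
  jacobi a (factors (factorise (suc t ℕ.* suc t)))       ≡⟨ e ⟩
  -1ℤ                                                    ∎)
  where
  f = factorise (suc t)
  ps = factors f
  doubled : PrimeFactorisation (suc t ℕ.* suc t)
  doubled = record
    { factors         = ps ++ ps
    ; isFactorisation = ≡.trans (cong₂ ℕ._*_ (PrimeFactorisation.isFactorisation f) (PrimeFactorisation.isFactorisation f))
                                (sym (product-++ ps ps))
    ; factorsPrime    = All.++⁺ (PrimeFactorisation.factorsPrime f) (PrimeFactorisation.factorsPrime f)
    }

-- Residues modulo 4 and reciprocity for odd integers of either sign

odd-abs : ∀ a → a ≡ 1ℤ [mod 2 ] → Odd ∣ a ∣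
odd-abs a a≡1 with even⊎odd ∣ a ∣
... | inj₂ odd        = odd
... | inj₁ (h , ∣a∣≡2h) with mod-small {i = 1} {0} (mod-trans (mod-sym a≡1)
        (∣⇒mod0 a (ℕ.divides h (≡.trans ∣a∣≡2h (double h))))) ℕ.≤-refl (ℕ.s≤s ℕ.z≤n)
  where
  double : ∀ h → h ℕ.+ h ≡ h ℕ.* 2
  double = solveℕ-∀
...   | ()

mod4-of-odd : ∀ {n} → Odd n → (+ n ≡ 1ℤ [mod 4 ] × χ n ≡ 1ℤ) ⊎ (+ n ≡ -1ℤ [mod 4 ] × χ n ≡ -1ℤ)
mod4-of-odd (h , ≡.refl) with even⊎odd h
... | inj₁ (k , ≡.refl) = inj₁ (quot (+ k) eq quadruple , ≡.trans (cong -1^_ (half-odd (k ℕ.+ k))) (-1^-double k))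
  where
  lemma : ∀ k → 1ℤ + (k + k + (k + k)) ≡ 1ℤ + k * + 4
  lemma = solve-∀
  quadruple : + suc (k ℕ.+ k ℕ.+ (k ℕ.+ k)) ≡ 1ℤ + + k * + 4
  quadruple = lemma (+ k)
... | inj₂ (k , ≡.refl) = inj₂ (quot (+ suc k) eq quadruple
    , ≡.trans (cong -1^_ (half-odd (suc (k ℕ.+ k)))) (cong (-1ℤ *_) (-1^-double k)))
  where
  lemma : ∀ k → 1ℤ + (1ℤ + (k + k) + (1ℤ + (k + k))) ≡ -1ℤ + (1ℤ + k) * + 4
  lemma = solve-∀
  quadruple : + suc (suc (k ℕ.+ k) ℕ.+ suc (k ℕ.+ k)) ≡ -1ℤ + + suc k * + 4
  quadruple = lemma (+ k)

1≢-1-mod4 : ¬ 1ℤ ≡ -1ℤ [mod 4 ]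
1≢-1-mod4 e with () ← mod-close e (ℕ.s≤s (ℕ.s≤s (ℕ.s≤s ℕ.z≤n)))

χ-pos : ∀ {n} → Odd n → + n ≡ 1ℤ [mod 4 ] → χ n ≡ 1ℤ
χ-pos odd n≡1 with mod4-of-odd odd
... | inj₁ (_ , χ≡1)   = χ≡1
... | inj₂ (n≡-1 , _) = contradiction (mod-trans (mod-sym n≡1) n≡-1) 1≢-1-mod4

χ-neg : ∀ {n} → Odd (suc n) → -[1+ n ] ≡ 1ℤ [mod 4 ] → χ (suc n) ≡ -1ℤ
χ-neg odd -n≡1 with mod4-of-odd odd
... | inj₁ (n≡1 , _)   = contradiction (mod-trans (mod-sym -n≡1) (mod-neg n≡1)) 1≢-1-mod4
... | inj₂ (_ , χ≡-1) = χ≡-1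

ε-trivialˡ : ∀ m n → χ m ≡ 1ℤ → ε m n ≡ 1ℤ
ε-trivialˡ m n χm≡1 = ≡.trans (ε-χ m n) (≡.trans (cong (_^ ⌊ n /2⌋) χm≡1) (ℤ.^-zeroˡ ⌊ n /2⌋))

-- If `χ n` is -1, then `ε m n` is (-1)^⌊m/2⌋, which is `χ m` again.
χ*ε-trivial : ∀ m n → χ m ≡ 1ℤ ⊎ χ n ≡ -1ℤ → χ m * ε m n ≡ 1ℤ
χ*ε-trivial m n (inj₁ χm≡1)  = cong₂ _*_ χm≡1 (ε-trivialˡ m n χm≡1)
χ*ε-trivial m n (inj₂ χn≡-1) = begin
  χ m * ε m n            ≡⟨ cong (χ m *_) (≡.trans (ε-comm m n) (ε-χ n m)) ⟩
  χ m * χ n ^ ⌊ m /2⌋    ≡⟨ cong (λ z → χ m * z ^ ⌊ m /2⌋) χn≡-1 ⟩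
  χ m * χ m              ≡⟨ -1^-isSign ⌊ m /2⌋ ⟩
  1ℤ                     ∎

-- The negative numerator contributes `χ` and reciprocity contributes `ε`. They cancel if either
-- entry is 1 modulo 4, where a negative entry that is 1 modulo 4 has absolute value 3 modulo 4.
kronecker-flip-pos-neg : ∀ m n → Odd (suc m) → Odd (suc n) →
  + suc m ≡ 1ℤ [mod 4 ] ⊎ -[1+ n ] ≡ 1ℤ [mod 4 ] →
  kronecker -[1+ n ] (+ suc m) ≡ kronecker (+ suc m) -[1+ n ]
kronecker-flip-pos-neg m n odd-m odd-n one = begin
  kronecker -[1+ n ] (+ suc m)                                          ≡⟨ kronecker-neg odd-m n ⟩
  χ (suc m) * kronecker (+ suc n) (+ suc m)                             ≡⟨ cong (χ (suc m) *_) (kronecker-reciprocity odd-m odd-n) ⟩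
  χ (suc m) * (ε (suc m) (suc n) * kronecker (+ suc m) (+ suc n))       ≡⟨ ℤ.*-assoc (χ (suc m)) _ _ ⟨
  χ (suc m) * ε (suc m) (suc n) * kronecker (+ suc m) (+ suc n)         ≡⟨ cong (_* kronecker (+ suc m) (+ suc n)) (χ*ε-trivial (suc m) (suc n) signs) ⟩
  1ℤ * kronecker (+ suc m) (+ suc n)                                    ∎
  where
  signs : χ (suc m) ≡ 1ℤ ⊎ χ (suc n) ≡ -1ℤ
  signs = [ inj₁ ∘ χ-pos odd-m , inj₂ ∘ χ-neg odd-n ]′ one

kronecker-flip-pos : ∀ m b → Odd (suc m) → Odd ∣ b ∣ → + suc m ≡ 1ℤ [mod 4 ] ⊎ b ≡ 1ℤ [mod 4 ] →
  kronecker b (+ suc m) ≡ kronecker (+ suc m) b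
kronecker-flip-pos m (+ suc n) odd-m odd-n one = ≡.trans (kronecker-reciprocity odd-m odd-n)
  (≡.trans (cong (_* kronecker (+ suc m) (+ suc n)) (trivial one)) (ℤ.*-identityˡ _))
  where
  trivial : + suc m ≡ 1ℤ [mod 4 ] ⊎ + suc n ≡ 1ℤ [mod 4 ] → ε (suc m) (suc n) ≡ 1ℤ
  trivial (inj₁ m≡1) = ε-trivialˡ (suc m) (suc n) (χ-pos odd-m m≡1)
  trivial (inj₂ n≡1) = ≡.trans (ε-comm (suc m) (suc n)) (ε-trivialˡ (suc n) (suc m) (χ-pos odd-n n≡1))
kronecker-flip-pos m -[1+ n ]  odd-m odd-n one = kronecker-flip-pos-neg m n odd-m odd-n one

mod4⇒mod2 : ∀ {x y} → x ≡ y [mod 4 ] → x ≡ y [mod 2 ]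
mod4⇒mod2 {x} {y} e = ∣⇒mod x y (ℕ.∣-trans (ℕ.divides 2 ≡.refl) (mod⇒∣ e))

-- Denominators that are not squares

record Admissible (x y : ℤ) : Set where
  field
    oddˣ : x ≡ 1ℤ [mod 2 ]
    oddʸ : y ≡ 1ℤ [mod 2 ]
    one  : x ≡ 1ℤ [mod 4 ] ⊎ y ≡ 1ℤ [mod 4 ]

-- With two negative entries reciprocity changes sign, but then all later denominators are negative.
data Obstructed : ℤ → ℤ → Set where
  bothNegative : ∀ m n → Obstructed -[1+ m ] -[1+ n ]
  symbol       : ∀ {x y} → kronecker x y ≡ -1ℤ → Obstructed x y

module _ (k : ℕ) where

  private
    a = 4 ℕ.* suc k

  shift-mod4 : ∀ x y → x + + a * y ≡ x [mod 4 ]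
  shift-mod4 x y = quot (+ suc k * y) eq ≡.trans (cong (λ z → x + z * y) (ℤ.pos-* 4 (suc k))) (lemma x y (+ suc k))
    where
    lemma : ∀ x y k → x + + 4 * k * y ≡ x + k * y * + 4
    lemma = solve-∀

  -- Modulo 4 a step merely swaps the two entries.
  admissible-step : ∀ {x y} → Admissible x y → Admissible y (x + + a * y)
  admissible-step {x} {y} adm = record
    { oddˣ = oddʸ
    ; oddʸ = mod-trans (mod4⇒mod2 (shift-mod4 x y)) oddˣ
    ; one  = [ inj₂ ∘ mod-trans (shift-mod4 x y) , inj₁ ]′ one
    }
    where open Admissible adm

  shift-mod-pos : ∀ x n → x + + a * + n ≡ x [mod n ]
  shift-mod-pos x n = quot (+ a) eq ≡.refl

  shift-mod-neg : ∀ x n → x + + a * -[1+ n ] ≡ x [mod suc n ]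
  shift-mod-neg x n = quot (- + a) eq cong (λ z → x + z) (lemma (+ a) (+ suc n))
    where
    lemma : ∀ a n → a * - n ≡ - a * n
    lemma = solve-∀

  -- For y > 0 the new symbol is flipped and then reduced modulo y to the old one. For x ≥ 0 > y the
  -- same works if the new entry is positive; if it is negative, both entries are negative from then
  -- on.
  obstructed-step : ∀ x y → Admissible x y → Obstructed x y → Obstructed y (x + + a * y)
  -- As a > 0, the new entry computes to a negative numeral, whose index is inferred.
  obstructed-step _ _ _ (bothNegative m n) = bothNegative n _
  obstructed-step x (+ zero) adm (symbol _) with () ← odd-abs 0ℤ (Admissible.oddʸ adm)
  obstructed-step x (+ suc n) adm (symbol e) = symbol (≡.trans
    (sym (kronecker-flip-pos n v odd-n (odd-abs v (oddʸ adm′)) (one adm′)))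
    (≡.trans (kronecker-mod odd-n (shift-mod-pos x (suc n))) e))
    where
    open Admissible
    v = x + + a * + suc n
    adm′ = admissible-step adm
    odd-n = odd-abs (+ suc n) (oddʸ adm)
  obstructed-step -[1+ m ] -[1+ n ] adm (symbol _) = bothNegative n _
  obstructed-step (+ m) -[1+ n ] adm (symbol e) = sign-cases (+ m + + a * -[1+ n ]) (admissible-step adm) (shift-mod-neg (+ m) n)
    where
    open Admissible
    odd-n : Odd (suc n)
    odd-n = odd-abs -[1+ n ] (oddʸ adm)
    sign-cases : ∀ v → Admissible -[1+ n ] v → v ≡ + m [mod suc n ] → Obstructed -[1+ n ] v
    sign-cases -[1+ w ]  _    _   = bothNegative n w
    sign-cases (+ zero)  adm′ _   with () ← odd-abs 0ℤ (oddʸ adm′)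
    sign-cases (+ suc w) adm′ v≡m = symbol (begin
      kronecker -[1+ n ] (+ suc w)           ≡⟨ kronecker-flip-pos-neg w n (odd-abs (+ suc w) (oddʸ adm′)) odd-n ([ inj₂ , inj₁ ]′ (one adm′)) ⟩
      1ℤ * kronecker (+ suc w) (+ suc n)     ≡⟨ cong (1ℤ *_) (kronecker-mod odd-n v≡m) ⟩
      1ℤ * kronecker (+ m) (+ suc n)         ≡⟨ e ⟩
      -1ℤ                                    ∎)

obstructed⇒nonsquare : ∀ x y → Admissible x y → Obstructed x y → ∀ s → y ≢ s * s
obstructed⇒nonsquare _ _ _ (bothNegative m n) s e = square-nonNegative s e
  where
  square-nonNegative : ∀ s → -[1+ n ] ≢ s * s
  square-nonNegative (+ t) e′ with () ← ≡.trans e′ (sym (ℤ.pos-* t t))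
obstructed⇒nonsquare x _ adm (symbol e) s ≡.refl = square-case ∣ s ∣ (square≡ s)
  where
  square≡ : ∀ s → s * s ≡ + (∣ s ∣ ℕ.* ∣ s ∣)
  square≡ (+ t)    = sym (ℤ.pos-* t t)
  square≡ -[1+ t ] = ≡.refl
  square-case : ∀ t → s * s ≢ + (t ℕ.* t)
  square-case zero    s²≡0  with () ← odd-abs 0ℤ (subst (_≡ 1ℤ [mod 2 ]) s²≡0 (Admissible.oddʸ adm))
  square-case (suc t) s²≡t² = kronecker-square≢-1 x t (≡.trans (cong (kronecker x) (sym s²≡t²)) e)

module _ {A : ℕ → Set} (A⊆4ℤ⁺ : ∀ a → A a → Σ ℕ λ k → a ≡ 4 ℕ.* suc k) where

  -- Words grow on the right, so the last generator acts first on the vector. The induction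
  -- therefore varies x and y and carries the two invariants along.
  denominators-nonsquare : ∀ {γ} → InΨ A γ → ∀ x y → Admissible x y → Obstructed x y →
    ∀ s → Mat.m21 γ * x + Mat.m22 γ * y ≢ s * s
  denominators-nonsquare ψ-id x y adm obs s e = obstructed⇒nonsquare x y adm obs s (≡.trans (identity x y) e)
    where
    identity : ∀ x y → y ≡ 0ℤ * x + 1ℤ * y
    identity = solve-∀
  denominators-nonsquare (ψ-mul {mat _ _ c d} {a} γ∈Ψ a∈A) x y adm obs s e
    with k , ≡.refl ← A⊆4ℤ⁺ a a∈A =
      denominators-nonsquare γ∈Ψ y (x + + a * y) (admissible-step k adm) (obstructed-step k x y adm obs) s
        (≡.trans (first-step c d x y (+ a)) e)
    where
    first-step : ∀ c d x y a → c * y + d * (x + a * y) ≡ (c * 0ℤ + d * 1ℤ) * x + (c * 1ℤ + d * a) * y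
    first-step = solve-∀

-- Inverses modulo n

inverse-mod-prime : ∀ {p} → Prime p → ∀ a → ¬ a ≡ 0ℤ [mod p ] → ∃ λ u → a * u ≡ 1ℤ [mod p ]
inverse-mod-prime {p} pr a a≢0 = bézout (coprime-Bézout (prime⇒coprime pr (n%ℕd<d a p)))
  where
  instance
    p-nonZero : ℕ.NonZero p
    p-nonZero = prime⇒nonZero pr
    r-nonZero : ℕ.NonZero (a %ℕ p)
    r-nonZero = ℕ.≢-nonZero λ r≡0 → a≢0 (mod-trans (mod-%ℕ a) (≡⇒mod (cong +_ r≡0)))
  r = a %ℕ p
  bézout : Bézout.Identity 1 p r → ∃ λ u → a * u ≡ 1ℤ [mod p ]
  bézout (Bézout.+- s t 1+tr≡sp) = - + t , mod-trans (mod-* (mod-%ℕ a) (≡⇒mod ≡.refl)) (quot (- + s) eq (begin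
    + r * - + t               ≡⟨ lemma (+ r) (+ t) ⟩
    1ℤ - (1ℤ + + t * + r)     ≡⟨ cong (λ z → 1ℤ - (1ℤ + z)) (ℤ.pos-* t r) ⟨
    1ℤ - + (1 ℕ.+ t ℕ.* r)    ≡⟨ cong (λ z → 1ℤ - + z) 1+tr≡sp ⟩
    1ℤ - + (s ℕ.* p)          ≡⟨ cong (λ z → 1ℤ - z) (ℤ.pos-* s p) ⟩
    1ℤ - + s * + p            ≡⟨ cong (λ z → 1ℤ + z) (ℤ.neg-distribˡ-* (+ s) (+ p)) ⟩
    1ℤ + - + s * + p          ∎))
    where
    lemma : ∀ r t → r * - t ≡ 1ℤ - (1ℤ + t * r)
    lemma = solve-∀
  bézout (Bézout.-+ s t 1+sp≡tr) = + t , mod-trans (mod-* (mod-%ℕ a) (≡⇒mod ≡.refl)) (quot (+ s) eq (begin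
    + r * + t                 ≡⟨ ℤ.*-comm (+ r) (+ t) ⟩
    + t * + r                 ≡⟨ ℤ.pos-* t r ⟨
    + (t ℕ.* r)               ≡⟨ cong +_ 1+sp≡tr ⟨
    1ℤ + + (s ℕ.* p)          ≡⟨ cong (λ z → 1ℤ + z) (ℤ.pos-* s p) ⟩
    1ℤ + + s * + p            ∎))

-- With v = u + w - a u w, the number 1 - a v factors as (1 - a u)(1 - a w), a multiple of m n.
inverse-mod-* : ∀ {m n} a → (∃ λ u → a * u ≡ 1ℤ [mod m ]) → (∃ λ w → a * w ≡ 1ℤ [mod n ]) →
  ∃ λ v → a * v ≡ 1ℤ [mod m ℕ.* n ]
inverse-mod-* {m} {n} a (u , quot q eq au) (w , quot r eq aw) = u + w - a * u * w , quot (- (q * r)) eq (begin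
  a * (u + w - a * u * w)                               ≡⟨ complement a u w ⟩
  1ℤ - (1ℤ - a * u) * (1ℤ - a * w)                      ≡⟨ cong₂ (λ b c → 1ℤ - (1ℤ - b) * (1ℤ - c)) au aw ⟩
  1ℤ - (1ℤ - (1ℤ + q * + m)) * (1ℤ - (1ℤ + r * + n))    ≡⟨ collect q r (+ m) (+ n) ⟩
  1ℤ + - (q * r) * (+ m * + n)                          ≡⟨ cong (λ z → 1ℤ + - (q * r) * z) (ℤ.pos-* m n) ⟨
  1ℤ + - (q * r) * + (m ℕ.* n)                          ∎)
  where
  complement : ∀ a u w → a * (u + w - a * u * w) ≡ 1ℤ - (1ℤ - a * u) * (1ℤ - a * w)
  complement = solve-∀
  collect : ∀ q r m n → 1ℤ - (1ℤ - (1ℤ + q * m)) * (1ℤ - (1ℤ + r * n)) ≡ 1ℤ + - (q * r) * (m * n)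
  collect = solve-∀

module _ (x z : ℤ) (coprime : ∀ {p} → Prime p → x ≡ 0ℤ [mod p ] → ¬ z ≡ 0ℤ [mod p ]) where

  -- If the term b reached so far is divisible by the next prime p, then j grows by the product P of
  -- the earlier primes. This adds z P, which is 0 modulo P but not modulo p: p does not divide z by
  -- coprimality, nor P, as b is a unit modulo P.
  progression-unit-product : ∀ {ps} → All Prime ps →
    ∃₂ λ j u → (x + + j * z) * u ≡ 1ℤ [mod product ps ]
  -- Modulo the empty product 1 any number is an inverse; 0 is taken.
  progression-unit-product [] = 0 , 0ℤ , quot ((x + 0ℤ * z) * 0ℤ - 1ℤ) eq lemma ((x + 0ℤ * z) * 0ℤ)
    where
    lemma : ∀ b → b ≡ 1ℤ + (b - 1ℤ) * 1ℤ
    lemma = solve-∀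
  progression-unit-product {p ∷ ps} (pr ∷ prs) with progression-unit-product prs
  ... | j , u , unit with p ℕ.∣? ∣ x + + j * z ∣
  ...   | no p∤ = j , inverse-mod-* (x + + j * z) (inverse-mod-prime pr (x + + j * z) (p∤ ∘ mod0⇒∣)) (u , unit)
  ...   | yes p∣ = j ℕ.+ P , inverse-mod-* b′ (inverse-mod-prime pr b′ b′≢0)
                     (u , mod-trans (mod-* b′≡b (≡⇒mod ≡.refl)) unit)
    where
    P = product ps
    b  = x + + j * z
    b′ = x + + (j ℕ.+ P) * z
    b≡0 : b ≡ 0ℤ [mod p ]
    b≡0 = ∣⇒mod0 b p∣
    expand : ∀ x j P z → x + (j + P) * z ≡ x + j * z + z * P
    expand = solve-∀
    b′≡b : b′ ≡ b [mod P ]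
    b′≡b = quot z eq expand x (+ j) (+ P) z
    z≢0 : ¬ z ≡ 0ℤ [mod p ]
    z≢0 z≡0 = coprime pr (mod-trans (≡⇒mod (isolate x (+ j) z))
      (mod-+ b≡0 (mod-neg (mod-trans (mod-*ˡ (+ j) z≡0) (≡⇒mod (ℤ.*-zeroʳ (+ j))))))) z≡0
      where
      isolate : ∀ x j z → x ≡ x + j * z - j * z
      isolate = solve-∀
    P≢0 : ¬ + P ≡ 0ℤ [mod p ]
    P≢0 P≡0 = 1≢0-mod-prime pr (mod-trans (mod-sym (∣⇒mod (b * u) 1ℤ (ℕ.∣-trans (mod0⇒∣ P≡0) (mod⇒∣ unit)))) (mod-* b≡0 (≡⇒mod {a = u} ≡.refl)))
    b′≢0 : ¬ b′ ≡ 0ℤ [mod p ]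
    b′≢0 b′≡0 with mod-euclid pr z (+ P) (mod-trans (≡⇒mod difference) (mod-+ b′≡0 (mod-neg b≡0)))
      where
      isolate : ∀ x j P z → z * P ≡ x + (j + P) * z - (x + j * z)
      isolate = solve-∀
      difference : z * + P ≡ b′ - b
      difference = isolate x (+ j) (+ P) z
    ... | inj₁ z≡0 = z≢0 z≡0
    ... | inj₂ P≡0 = P≢0 P≡0

  progression-unit : ∀ n .{{_ : ℕ.NonZero n}} → ∃₂ λ j u → (x + + j * z) * u ≡ 1ℤ [mod n ]
  progression-unit n =
    let open PrimeFactorisation (factorise n) using (isFactorisation; factorsPrime)
        j , u , unit = progression-unit-product factorsPrime
    in j , u , subst ((x + + j * z) * u ≡ 1ℤ [mod_]) (sym isFactorisation) unit

-- Denominators congruent to 1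

module _ (A : ℕ → Set) (4∈A : A 4) (8∈A : A 8) (n : ℕ) .{{_ : ℕ.NonZero n}} where

  -- The lemmas on `Hits` run backwards along the orbit: a hit from a later pair gives one from an
  -- earlier pair.
  Hits : ℤ → ℤ → Set
  Hits x y = Σ ℤ λ v → Denominator A x y v × v ≡ 1ℤ [mod n ]

  hits-one : ∀ {x y} → y ≡ 1ℤ [mod n ] → Hits x y
  hits-one {x} {y} y≡1 = y , (I₂ , ψ-id , identity x y) , y≡1
    where
    identity : ∀ x y → 0ℤ * x + 1ℤ * y ≡ y
    identity = solve-∀

  hits-step : ∀ {a} → A a → ∀ {x y} → Hits y (x + + a * y) → Hits x y
  hits-step {a} a∈A {x} {y} (v , (γ@(mat _ _ c d) , γ∈Ψ , e) , v≡1) =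
    v , (γ ⊗ gen a , ψ-mul γ∈Ψ a∈A , ≡.trans (first-step c d x y (+ a)) e) , v≡1
    where
    first-step : ∀ c d x y a → (c * 0ℤ + d * 1ℤ) * x + (c * 1ℤ + d * a) * y ≡ c * y + d * (x + a * y)
    first-step = solve-∀

  hits-mod : ∀ {x y x′ y′} → x ≡ x′ [mod n ] → y ≡ y′ [mod n ] → Hits x′ y′ → Hits x y
  hits-mod {x} {y} x≡x′ y≡y′ (_ , (γ , γ∈Ψ , ≡.refl) , v≡1) =
    Mat.m21 γ * x + Mat.m22 γ * y , (γ , γ∈Ψ , ≡.refl) ,
    mod-trans (mod-+ (mod-*ˡ (Mat.m21 γ) x≡x′) (mod-*ˡ (Mat.m22 γ) y≡y′)) v≡1

  iter : ℕ → ℤ × ℤ → ℤ × ℤ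
  iter zero    w = w
  iter (suc k) w = let x , y = iter k w in y , x + + 4 * y

  _≋_ : ℤ × ℤ → ℤ × ℤ → Set
  (x , y) ≋ (x′ , y′) = x ≡ x′ [mod n ] × y ≡ y′ [mod n ]

  private
    isolate : ∀ x y → x ≡ x + + 4 * y - + 4 * y
    isolate = solve-∀

  -- A step is invertible modulo n, x being recovered as (x + 4 y) - 4 y, so i common steps can be
  -- undone.
  iter-cancel : ∀ i d w → iter i w ≋ iter (i ℕ.+ d) w → w ≋ iter d w
  iter-cancel zero    d w e           = e
  iter-cancel (suc i) d w (y≡y′ , e) = iter-cancel i d w
    (mod-trans (≡⇒mod (isolate _ _)) (mod-trans (mod-+ e (mod-neg (mod-*ˡ (+ 4) y≡y′))) (≡⇒mod (sym (isolate _ _)))) , y≡y′)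

  hits-iter : ∀ k w → Hits (proj₁ (iter k w)) (proj₂ (iter k w)) → Hits (proj₁ w) (proj₂ w)
  hits-iter zero    w hit = hit
  hits-iter (suc k) w hit = hits-iter k w (hits-step 4∈A hit)

  -- Among n² + 1 iterates two agree modulo n, as there are n² pairs of residues; cancelling the
  -- common steps brings the coincidence back to the start.
  returns : ∀ w → ∃ λ d → w ≋ iter (suc d) w
  returns w with pigeonhole (ℕ.n<1+n (n ℕ.* n)) residues
    where
    residue : ℤ → Fin n
    residue a = fromℕ< (n%ℕd<d a n)
    residues : Fin (suc (n ℕ.* n)) → Fin (n ℕ.* n)
    residues i = combine (residue (proj₁ (iter (toℕ i) w))) (residue (proj₂ (iter (toℕ i) w)))
  ... | i , j , i<j , same with ℕ.m≤n⇒∃[o]m+o≡n i<j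
  ...   | d , 1+i+d≡j with combine-injective _ _ _ _ same
  ...     | same₁ , same₂ = d , iter-cancel (toℕ i) (suc d) w
    (subst (λ k → iter (toℕ i) w ≋ iter k w) (sym (≡.trans (ℕ.+-suc (toℕ i) d) 1+i+d≡j))
      (same-residue same₁ , same-residue same₂))
    where
    same-residue : ∀ {a b} → fromℕ< (n%ℕd<d a n) ≡ fromℕ< (n%ℕd<d b n) → a ≡ b [mod n ]
    same-residue {a} {b} e = mod-trans (mod-%ℕ a)
      (mod-trans (≡⇒mod (cong +_ (fromℕ<-injective _ _ (n%ℕd<d a n) (n%ℕd<d b n) e))) (mod-sym (mod-%ℕ b)))

  -- Modulo n the generator with a = 4 has finite order, so its inverse is a power of it.
  hits-inverse : ∀ {x y} → Hits (y - + 4 * x) x → Hits x y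
  hits-inverse {x} {y} hit = let d , x≡ , y≡ = returns (x , y) in
    hits-iter d (x , y) (hits-mod
      (mod-trans (≡⇒mod (isolate _ _)) (mod-+ (mod-sym y≡) (mod-neg (mod-*ˡ (+ 4) (mod-sym x≡)))))
      (mod-sym x≡) hit)

  -- The step with 8 leads to (y, x + 8 y), and undoing a step with 4 leads to (x + 4 y, y). In
  -- `hits-lower` the two moves come in the opposite order.
  hits-upper : ∀ {x y} → Hits (x + + 4 * y) y → Hits x y
  hits-upper {x} {y} hit = hits-step 8∈A (hits-inverse (subst (λ u → Hits u y) (lemma x y) hit))
    where
    lemma : ∀ x y → x + + 4 * y ≡ x + + 8 * y - + 4 * y
    lemma = solve-∀

  hits-lower : ∀ {x y} → Hits x (y + + 4 * x) → Hits x y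
  hits-lower {x} {y} hit = hits-inverse (hits-step 8∈A (subst (Hits x) (lemma x y) hit))
    where
    lemma : ∀ x y → y + + 4 * x ≡ y - + 4 * x + + 8 * x
    lemma = solve-∀

  hits-upper^ : ∀ k {x y} → Hits (x + + k * (+ 4 * y)) y → Hits x y
  hits-upper^ zero    {x} {y} hit = subst (λ u → Hits u y) (ℤ.+-identityʳ x) hit
  hits-upper^ (suc k) {x} {y} hit = hits-upper^ k (hits-upper (subst (λ u → Hits u y) (lemma x (+ k) y) hit))
    where
    lemma : ∀ x k y → x + (1ℤ + k) * (+ 4 * y) ≡ x + k * (+ 4 * y) + + 4 * y
    lemma = solve-∀

  hits-lower^ : ∀ k {x y} → Hits x (y + + k * (+ 4 * x)) → Hits x y
  hits-lower^ zero    {x} {y} hit = subst (Hits x) (ℤ.+-identityʳ y) hit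
  hits-lower^ (suc k) {x} {y} hit = hits-lower^ k (hits-lower (subst (Hits x) (lemma x (+ k) y) hit))
    where
    lemma : ∀ x k y → y + (1ℤ + k) * (+ 4 * x) ≡ y + k * (+ 4 * x) + + 4 * x
    lemma = solve-∀

  hits-unit : ∀ {x y u} → y ≡ 1ℤ [mod 4 ] → x * u ≡ 1ℤ [mod n ] → Hits x y
  -- With y = 1 + 4 q, the multiplier k must satisfy 4 k x ≡ -4 q; k ≡ -q u does, u being inverse to
  -- x. Its residue is taken because k counts moves.
  hits-unit {x} {y} {u} (quot q eq y≡1+4q) unit = hits-lower^ ((- q * u) %ℕ n) (hits-one
    (mod-trans (mod-+ (≡⇒mod {a = y} ≡.refl) (mod-* (mod-sym (mod-%ℕ (- q * u))) (≡⇒mod {a = + 4 * x} ≡.refl)))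
    (mod-trans (≡⇒mod (regroup y q u x))
    (mod-trans (mod-+ (≡⇒mod {a = y} ≡.refl) (mod-neg (mod-*ˡ (q * + 4) unit)))
    (≡⇒mod (≡.trans (cong (λ z → z - q * + 4 * 1ℤ) y≡1+4q) (cancel q)))))))
    where
    regroup : ∀ y q u x → y + - q * u * (+ 4 * x) ≡ y - q * + 4 * (x * u)
    regroup = solve-∀
    cancel : ∀ q → 1ℤ + q * + 4 - q * + 4 * 1ℤ ≡ 1ℤ
    cancel = solve-∀

  hits : ∀ x y → y ≡ 1ℤ [mod 4 ] →
    (∀ {p} → Prime p → x ≡ 0ℤ [mod p ] → ¬ + 4 * y ≡ 0ℤ [mod p ]) → Hits x y
  hits x y y≡1 coprime = let j , u , unit = progression-unit x (+ 4 * y) coprime n in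
    hits-upper^ j (hits-unit y≡1 unit)

-- Coprimality from the symbol

∏-zero : ∀ {A : Set} (f : A → ℤ) {x xs} → x ∈ xs → f x ≡ 0ℤ → ∏ xs f ≡ 0ℤ
∏-zero f {xs = _ ∷ xs} (here ≡.refl) fx≡0 = cong (_* ∏ xs f) fx≡0
∏-zero f {xs = y ∷ xs} (there x∈xs)  fx≡0 = ≡.trans (cong (f y *_) (∏-zero f x∈xs fx≡0)) (ℤ.*-zeroʳ (f y))

-- p is odd and occurs among the prime factors of the denominator, where its Legendre symbol is a
-- vanishing factor.
kronecker-common-prime : ∀ {x p n} → Prime p → Odd (suc n) → x ≡ 0ℤ [mod p ] → p ℕ.∣ suc n →
  kronecker x (+ suc n) ≡ 0ℤ
kronecker-common-prime {x} {p} {n} pr odd-n x≡0 p∣n@(ℕ.divides m n≡mp)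
  with h , ≡.refl ← odd-*ʳ m p (subst Odd n≡mp odd-n) = ∏-zero (legendre x) p∈ps legendre≡0
  where
  open PrimeFactorisation (factorise (suc n)) using (isFactorisation; factorsPrime)
  p∈ps : p ∈ factors (factorise (suc n))
  p∈ps = factorisationHasAllPrimeFactors pr (subst (p ℕ.∣_) isFactorisation p∣n) factorsPrime
  legendre≡0 : legendre x p ≡ 0ℤ
  legendre≡0 with legendre x p | legendreView x (Legendre.3≤p h pr)
  ... | _ | divisible _      = ≡.refl
  ... | _ | square _ x≢0 _   = contradiction x≡0 x≢0
  ... | _ | nonsquare x≢0 _  = contradiction x≡0 x≢0

-- A common prime would make the symbol 0, whatever the signs of x and y.
symbol⇒coprime : ∀ x y → kronecker x y ≡ -1ℤ → y ≡ 1ℤ [mod 2 ] →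
  ∀ {p} → Prime p → x ≡ 0ℤ [mod p ] → ¬ y ≡ 0ℤ [mod p ]
symbol⇒coprime x (+ zero) _ odd-y _ _ _ with () ← odd-abs 0ℤ odd-y
symbol⇒coprime x (+ suc n) e odd-y pr x≡0 y≡0
  with () ← ≡.trans (sym e) (kronecker-common-prime pr (odd-abs (+ suc n) odd-y) x≡0 (mod0⇒∣ y≡0))
symbol⇒coprime (+ m) -[1+ n ] e odd-y pr x≡0 y≡0
  with () ← ≡.trans (sym e) (cong (1ℤ *_) (kronecker-common-prime {+ m} pr (odd-abs -[1+ n ] odd-y) x≡0 (mod0⇒∣ y≡0)))
symbol⇒coprime -[1+ m ] -[1+ n ] e odd-y pr x≡0 y≡0
  with () ← ≡.trans (sym e) (cong (-1ℤ *_) (kronecker-common-prime { -[1+ m ] } pr (odd-abs -[1+ n ] odd-y) x≡0 (mod0⇒∣ y≡0)))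

coprime-to-4y : ∀ {x y} → x ≡ 1ℤ [mod 2 ] →
  (∀ {p} → Prime p → x ≡ 0ℤ [mod p ] → ¬ y ≡ 0ℤ [mod p ]) →
  ∀ {p} → Prime p → x ≡ 0ℤ [mod p ] → ¬ + 4 * y ≡ 0ℤ [mod p ]
coprime-to-4y {x} {y} odd-x coprime {p} pr x≡0 4y≡0 with mod-euclid pr (+ 4) y 4y≡0
... | inj₂ y≡0 = coprime pr x≡0 y≡0
... | inj₁ 4≡0 = p∤2 (mod0⇒∣ ([ id , id ]′ (mod-euclid pr (+ 2) (+ 2) 4≡0)))
  where
  p∤2 : ¬ p ℕ.∣ 2
  p∤2 p∣2 with irreducible[2] p∣2
  ... | inj₁ ≡.refl = contradiction (prime⇒nonTrivial pr) λ ()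
  ... | inj₂ ≡.refl with () ← mod-small {i = 1} {0} (mod-trans (mod-sym odd-x) x≡0) ℕ.≤-refl (ℕ.s≤s ℕ.z≤n)

-- Local squares without integer squares among the denominators

odd⇒mod2 : ∀ x → ¬ (+ 2 ∣ x) → x ≡ 1ℤ [mod 2 ]
odd⇒mod2 x 2∤x with x %ℕ 2 | n%ℕd<d x 2 | mod-%ℕ {2} x
... | 0 | _ | x≡0 = contradiction (mod0⇒∣ x≡0) 2∤x
... | 1 | _ | x≡1 = x≡1
... | suc (suc _) | ℕ.s≤s (ℕ.s≤s ()) | _

theorem2p17 : (A : ℕ → Set)
    → ((a : ℕ) → A a → Σ ℕ λ k → a ≡ 4 Data.Nat.* suc k)
    → A 4 → A 8
    → (x y : ℤ)
    → (+ 4) ∣ (y Data.Integer.- + 1)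
    → ¬ ((+ 2) ∣ x)
    → kronecker x y ≡ -1ℤ
    → ReciprocityObstruction A x y
theorem2p17 A A⊆4ℤ⁺ 4∈A 8∈A x y 4∣y-1 2∤x symbol≡-1 = local-squares , no-squares
  where
  y≡1 : y ≡ 1ℤ [mod 4 ]
  y≡1 = ∣⇒mod y 1ℤ 4∣y-1
  odd-x : x ≡ 1ℤ [mod 2 ]
  odd-x = odd⇒mod2 x 2∤x
  odd-y : y ≡ 1ℤ [mod 2 ]
  odd-y = mod4⇒mod2 y≡1
  local-squares : (n : ℕ) → 1 ℕ.≤ n → Σ ℤ λ v → Denominator A x y v × Σ ℤ λ s → + n ∣ (v - s * s)
  -- For every modulus the square that is met is 1.
  local-squares (suc n) _ =
    let v , v∈ , v≡1 = hits A 4∈A 8∈A (suc n) x y y≡1 (coprime-to-4y odd-x (symbol⇒coprime x y symbol≡-1 odd-y))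
    in v , v∈ , 1ℤ , mod⇒∣ v≡1
  no-squares : (v : ℤ) → Denominator A x y v → (s : ℤ) → ¬ v ≡ s * s
  no-squares v (γ , γ∈Ψ , e) s v≡s² = denominators-nonsquare A⊆4ℤ⁺ γ∈Ψ x y
    (record { oddˣ = odd-x ; oddʸ = odd-y ; one = inj₂ y≡1 }) (symbol symbol≡-1) s (≡.trans e v≡s²)
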